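{- For bijective structures, and presentations with a single generator $a$ and two identities, the sentence $\varphi$ saying that the structure is a $1$-cycle (i.e., has exactly one element) does not have a limiting density.
   Context: The language has two unary function symbols $S,S^{ -1}$. The variety of bijective structures has axioms $(\forall x)\,SS^{ -1}(x)=x$ and $(\forall x)\,S^{ -1}S(x)=x$; let $T$ be the theory generated by these. A presentation here consists of a generator $a$ and an unordered set of two distinct identities, each of the form $t(a)=a$, where $t$ is an arbitrary (possibly empty, not necessarily reduced) finite string of the symbols $S,S^{ -1}$. The resulting structure is the bijective structure generated by $a$ in which the equations between closed terms in $a$ that hold are exactly those that follow logically from $T$ and the two identities. The length of an identity $t(a)=a$ is the number of function symbols in $t$. Let $P_s$ be the number of presentations in which both identities have length at most $s$ and $P_s(\varphi)$ the number of these whose resulting structure satisfies $\varphi$. The limiting density of $\varphi$ is $\lim_{s\to\infty}P_s(\varphi)/P_s$, if this limit exists. -}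

module Defs where

open import Data.Fin using (Fin)
open import Data.Integer using (+_)
open import Data.List using (List; []; _∷_; length)
open import Data.Nat as ℕ using (ℕ; zero; suc)
open import Data.Product using (Σ; ∃-syntax; _×_; _,_; proj₁)
open import Data.Rational using (ℚ; 0ℚ; _/_; _+_; _-_; _<_)
open import Data.Sum using (_⊎_; inj₁; inj₂)
open import Function.Bundles using (Bijection; _⇔_)
open import Level using (0ℓ)
open import Relation.Binary.Bundles using (Setoid)
open import Relation.Binary.PropositionalEquality
  using (_≡_; _≢_; refl; sym; trans)
  renaming (setoid to ≡-setoid)
import Relation.Binary.Construct.On as On
open import Relation.Nullary using (¬_)

record BijectiveStructure : Set₁ where
  field
    setoid : Setoid 0ℓ 0ℓ
  open Setoid setoid public using (Carrier; _≈_)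
  field
    S        : Carrier → Carrier
    S⁻¹      : Carrier → Carrier
    S-cong   : ∀ {x y} → x ≈ y → S x ≈ S y
    S⁻¹-cong : ∀ {x y} → x ≈ y → S⁻¹ x ≈ S⁻¹ y
    SS⁻¹     : ∀ x → S (S⁻¹ x) ≈ x
    S⁻¹S     : ∀ x → S⁻¹ (S x) ≈ x

IsOneCycle : BijectiveStructure → Set
IsOneCycle B = ∃[ x ] (∀ y → y ≈ x)
  where open BijectiveStructure B

data Symbol : Set where
  S S⁻¹ : Symbol

-- A word t stands for the identity t(a) = a; words need not be reduced, so
-- distinct words give distinct identities.
Word : Set
Word = List Symbol

data Term : Set where
  a     : Term
  apply : Symbol → Term → Term

_·_ : Word → Term → Term
[]      · x = x
(f ∷ t) · x = apply f (t · x)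

record Presentation : Set where
  constructor presentation
  field
    word₁ word₂ : Word
    distinct    : word₁ ≢ word₂

open Presentation public

-- Equality of presentations as unordered pairs of identities.
_≋_ : Presentation → Presentation → Set
p ≋ q = (word₁ p ≡ word₁ q × word₂ p ≡ word₂ q)
      ⊎ (word₁ p ≡ word₂ q × word₂ p ≡ word₁ q)

presentationSetoid : Setoid 0ℓ 0ℓ
presentationSetoid = record
  { Carrier       = Presentation
  ; _≈_           = _≋_
  ; isEquivalence = record
    { refl  = inj₁ (refl , refl)
    ; sym   = λ where
        (inj₁ (e , f)) → inj₁ (sym e , sym f)
        (inj₂ (e , f)) → inj₂ (sym f , sym e)
    ; trans = λ where
        (inj₁ (e , f)) (inj₁ (g , h)) → inj₁ (trans e g , trans f h)
        (inj₁ (e , f)) (inj₂ (g , h)) → inj₂ (trans e g , trans f h)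
        (inj₂ (e , f)) (inj₁ (g , h)) → inj₂ (trans e h , trans f g)
        (inj₂ (e , f)) (inj₂ (g , h)) → inj₁ (trans e h , trans f g)
    }
  }

-- Derivability in equational logic from the two axioms of bijective structures
-- and the two identities of p.  Since only equations between closed terms are
-- derived, the axioms enter through their closed instances.
data _⊢_≈_ (p : Presentation) : Term → Term → Set where
  ⊢-refl    : ∀ {x} → p ⊢ x ≈ x
  ⊢-sym     : ∀ {x y} → p ⊢ x ≈ y → p ⊢ y ≈ x
  ⊢-trans   : ∀ {x y z} → p ⊢ x ≈ y → p ⊢ y ≈ z → p ⊢ x ≈ z
  ⊢-cong    : ∀ f {x y} → p ⊢ x ≈ y → p ⊢ apply f x ≈ apply f y
  axiom-SS⁻¹ : ∀ x → p ⊢ apply S (apply S⁻¹ x) ≈ x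
  axiom-S⁻¹S : ∀ x → p ⊢ apply S⁻¹ (apply S x) ≈ x
  identity₁ : p ⊢ word₁ p · a ≈ a
  identity₂ : p ⊢ word₂ p · a ≈ a

⟨_⟩ : Presentation → BijectiveStructure
⟨ p ⟩ = record
  { setoid   = record
    { Carrier       = Term
    ; _≈_           = p ⊢_≈_
    ; isEquivalence = record { refl = ⊢-refl ; sym = ⊢-sym ; trans = ⊢-trans }
    }
  ; S        = apply S
  ; S⁻¹      = apply S⁻¹
  ; S-cong   = ⊢-cong S
  ; S⁻¹-cong = ⊢-cong S⁻¹
  ; SS⁻¹     = axiom-SS⁻¹
  ; S⁻¹S     = axiom-S⁻¹S
  }

HasLengthAtMost : ℕ → Presentation → Set
HasLengthAtMost s p = length (word₁ p) ℕ.≤ s × length (word₂ p) ℕ.≤ s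

_∣_ : (A : Setoid 0ℓ 0ℓ) → (Setoid.Carrier A → Set) → Setoid 0ℓ 0ℓ
A ∣ Q = On.setoid {B = Σ (Setoid.Carrier A) Q} A proj₁

HasCardinality : Setoid 0ℓ 0ℓ → ℕ → Set
HasCardinality A n = Bijection (≡-setoid (Fin n)) A

-- n = P_s
IsP : ℕ → ℕ → Set
IsP s n = HasCardinality (presentationSetoid ∣ HasLengthAtMost s) n

-- n = P_s(φ)
IsP[_] : (BijectiveStructure → Set) → ℕ → ℕ → Set
IsP[ φ ] s n =
  HasCardinality (presentationSetoid ∣ λ p → HasLengthAtMost s p × φ ⟨ p ⟩) n

-- Dedekind reals: Lower q means q < x, Upper q means x < q.
record ℝ : Set₁ where
  field
    Lower Upper     : ℚ → Set
    lower-inhabited : ∃[ q ] Lower q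
    upper-inhabited : ∃[ q ] Upper q
    lower-rounded   : ∀ q → Lower q ⇔ (∃[ r ] (q < r × Lower r))
    upper-rounded   : ∀ r → Upper r ⇔ (∃[ q ] (q < r × Upper q))
    disjoint        : ∀ q → ¬ (Lower q × Upper q)
    located         : ∀ {q r} → q < r → Lower q ⊎ Upper r

-- | q - x | < ε
_isWithin_of_ : ℚ → ℚ → ℝ → Set
q isWithin ε of x = ℝ.Lower x (q - ε) × ℝ.Upper x (q + ε)

_⟶_ : (ℕ → ℚ) → ℝ → Set
u ⟶ x = ∀ ε → 0ℚ < ε → ∃[ N ] (∀ s → N ℕ.≤ s → u s isWithin ε of x)

-- The value for denominator 0 is a dummy; it is used only at s = 0, where
-- there are no two distinct identities.
ratio : ℕ → ℕ → ℚ
ratio m zero    = 0ℚ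
ratio m (suc n) = + m / suc n

-- The counting functions are determined by their specifications.  Quantifying
-- over all functions that meet them means that refuting a limiting density
-- cannot exploit a failure to compute the counts.
IsLimitingDensity : (BijectiveStructure → Set) → ℝ → Set
IsLimitingDensity φ x =
  (P Pφ : ℕ → ℕ) →
  (∀ s → IsP s (P s)) →
  (∀ s → IsP[ φ ] s (Pφ s)) →
  (λ s → ratio (Pφ s) (P s)) ⟶ x

HasLimitingDensity : (BijectiveStructure → Set) → Set₁
HasLimitingDensity φ = ∃[ x ] IsLimitingDensity φ x

{-# OPTIONS --safe #-}

-- Let v(t) be the number of S minus the number of S⁻¹ in t.  The structure presented by t and u
-- is ℤ / (v(t), v(u)), so it is a 1-cycle iff v(t) and v(u) are coprime.  The values of words
-- are the end points of ±1-walks from 0, and a walk of n steps ends at a number congruent to n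
-- modulo 2.  About 2/3 of the words of length at most s have length of the same parity as s.
--
-- For even s, a proportion of about 4/9 of the pairs has both values even, so the ratio is at
-- most about 5/9, hence at most 4/7.  For odd s this proportion is only 1/9.  The remaining
-- non-coprime pairs have an odd common divisor d ≥ 3 or involve a value that is 0 or large
-- compared with √s.  As d divides a value with probability about 1/d (reflection principle),
-- the sum over d is at most about Σ 1/((d-1)(d+1)) = 1/4.  Along s = 4r² - 1 the ratio is
-- therefore eventually at least 7/12 > 4/7.
module Submission where

open import Defs

open import Data.Empty using (⊥)
open import Data.Integer as ℤ using (ℤ; +_; -[1+_]; 0ℤ; 1ℤ)
import Data.Integer.Divisibility.Signed as ℤ∣
open ℤ∣ using () renaming (_∣_ to _∣ℤ_; _∣?_ to _∣ℤ?_)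
import Data.Integer.Properties as ℤₚ
import Data.Integer.Tactic.RingSolver as ℤ-Solver
open import Data.Fin using (zero; suc)
open import Data.List using (List; []; _∷_; _++_; length; lookup; map; filter)
open import Data.List.Membership.Propositional using (_∈_)
open import Data.List.Membership.Propositional.Properties
  using (∈-lookup; ∈-map⁺; ∈-++⁺ˡ; ∈-++⁺ʳ)
import Data.List.Membership.Setoid.Properties as Setoid∈
open import Data.List.Properties using (filter-++; length-++; map-++; ∷-injectiveʳ)
open import Data.List.Relation.Unary.All as All using (All; []; _∷_)
import Data.List.Relation.Unary.All.Properties as Allₚ
open import Data.List.Relation.Unary.AllPairs using (AllPairs; []; _∷_)
import Data.List.Relation.Unary.AllPairs.Properties as AllPairsₚ
open import Data.List.Relation.Unary.Any as Any using (Any; here; there)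
import Data.List.Relation.Unary.Any.Properties as Anyₚ
open import Data.List.Relation.Unary.Unique.Propositional using (Unique)
import Data.List.Relation.Unary.Unique.Propositional.Properties as Uniqueₚ
open import Data.Nat as ℕ
  using (ℕ; zero; suc; _+_; _*_; _∸_; _≤_; _<_; z≤n; s≤s; _<?_)
import Data.Nat.Divisibility as ℕ∣
open import Data.Nat.GCD as GCD using (gcd; gcd[m,n]∣m; gcd[m,n]∣n; gcd-greatest)
open GCD.Bézout using (+-; -+)
open import Data.Nat.ListAction using (sum)
open import Data.Nat.ListAction.Properties using (sum-++)
open import Data.Nat.Properties
open import Data.Nat.Tactic.RingSolver using (solve-∀)
open import Data.Product using (_×_; _,_; proj₁; proj₂; ∃-syntax)
import Data.Rational as ℚ
open ℚ using (ℚ)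
import Data.Rational.Properties as ℚₚ
import Data.Rational.Unnormalised as ℚᵘ
import Data.Rational.Unnormalised.Properties as ℚᵘₚ
open import Data.Sum using (_⊎_; inj₁; inj₂)
open import Data.Unit using (tt)
open import Function using (_∘_)
open import Function.Bundles using (Equivalence)
open import Level using (0ℓ)
open import Relation.Binary.Bundles using (Setoid)
open import Relation.Binary.Definitions using (tri<; tri≈; tri>)
open import Relation.Binary.PropositionalEquality
open import Relation.Nullary using (¬_; Dec; yes; no; contradiction)
open import Relation.Nullary.Decidable using (_×-dec_; ¬?)

-- Indicators, finite sums and sums over walks

⟦_⟧ : ∀ {P : Set} → Dec P → ℕ
⟦ yes _ ⟧ = 1
⟦ no _ ⟧ = 0

⟦⟧-yes : ∀ {P : Set} (P? : Dec P) → P → ⟦ P? ⟧ ≡ 1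
⟦⟧-yes (yes _) _ = refl
⟦⟧-yes (no ¬p) p = contradiction p ¬p

⟦⟧-no : ∀ {P : Set} (P? : Dec P) → ¬ P → ⟦ P? ⟧ ≡ 0
⟦⟧-no (yes p) ¬p = contradiction p ¬p
⟦⟧-no (no _) _ = refl

⟦⟧≤1 : ∀ {P : Set} (P? : Dec P) → ⟦ P? ⟧ ≤ 1
⟦⟧≤1 (yes _) = ≤-refl
⟦⟧≤1 (no _) = z≤n

⟦⟧-mono : ∀ {P Q : Set} (P? : Dec P) (Q? : Dec Q) → (P → Q) → ⟦ P? ⟧ ≤ ⟦ Q? ⟧
⟦⟧-mono (yes p) Q? f = ≤-reflexive (sym (⟦⟧-yes Q? (f p)))
⟦⟧-mono (no _) Q? f = z≤n

⟦⟧-cong : ∀ {P Q : Set} (P? : Dec P) (Q? : Dec Q) → (P → Q) → (Q → P) → ⟦ P? ⟧ ≡ ⟦ Q? ⟧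
⟦⟧-cong P? Q? f g = ≤-antisym (⟦⟧-mono P? Q? f) (⟦⟧-mono Q? P? g)

sumBelow : ℕ → (ℕ → ℕ) → ℕ
sumBelow zero f = 0
sumBelow (suc n) f = sumBelow n f + f n

sumBelow-mono : ∀ n {f g : ℕ → ℕ} → (∀ {k} → k < n → f k ≤ g k) → sumBelow n f ≤ sumBelow n g
sumBelow-mono zero f≤g = z≤n
sumBelow-mono (suc n) f≤g = +-mono-≤ (sumBelow-mono n (f≤g ∘ m<n⇒m<1+n)) (f≤g ≤-refl)

sumBelow-+ : ∀ n (f g : ℕ → ℕ) → sumBelow n (λ k → f k + g k) ≡ sumBelow n f + sumBelow n g
sumBelow-+ zero f g = refl
sumBelow-+ (suc n) f g rewrite sumBelow-+ n f g = regroup (sumBelow n f) (sumBelow n g) (f n) (g n)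
  where
  regroup : ∀ w x y z → w + x + (y + z) ≡ w + y + (x + z)
  regroup = solve-∀

sumBelow-*ˡ : ∀ c n (f : ℕ → ℕ) → sumBelow n (λ k → c * f k) ≡ c * sumBelow n f
sumBelow-*ˡ c zero f = sym (*-zeroʳ c)
sumBelow-*ˡ c (suc n) f rewrite sumBelow-*ˡ c n f = sym (*-distribˡ-+ c (sumBelow n f) (f n))

sumBelow-const : ∀ n c → sumBelow n (λ _ → c) ≡ n * c
sumBelow-const zero c = refl
sumBelow-const (suc n) c rewrite sumBelow-const n c = +-comm (n * c) c

term≤sumBelow : ∀ {n k} (f : ℕ → ℕ) → k < n → f k ≤ sumBelow n f
term≤sumBelow {suc n} {k} f k<1+n with m≤n⇒m<n∨m≡n (≤-pred k<1+n)
... | inj₁ k<n  = ≤-trans (term≤sumBelow f k<n) (m≤m+n _ _)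
... | inj₂ refl = m≤n+m _ _

sumBelow-unique : ∀ n {P : ℕ → Set} (P? : ∀ k → Dec (P k)) →
  (∀ {i j} → i < j → j < n → P i → P j → ⊥) → sumBelow n (λ k → ⟦ P? k ⟧) ≤ 1
sumBelow-unique zero P? unique = z≤n
sumBelow-unique (suc n) P? unique with P? n
... | no _ = ≤-trans (≤-reflexive (+-identityʳ _))
  (sumBelow-unique n P? (λ i<j j<n → unique i<j (m<n⇒m<1+n j<n)))
... | yes Pn = +-monoˡ-≤ 1 (≤-trans
  (sumBelow-mono n (λ {k} k<n → ≤-reflexive (⟦⟧-no (P? k) (λ Pk → unique k<n ≤-refl Pk Pn))))
  (≤-reflexive (trans (sumBelow-const n 0) (*-zeroʳ n))))

-- The sum of f over the end points of all ±1-walks from x with at most s steps.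
walkSum : ℕ → (ℤ → ℕ) → ℤ → ℕ
walkSum zero f x = f x
walkSum (suc s) f x = f x + (walkSum s f (ℤ.suc x) + walkSum s f (ℤ.pred x))

walkSum-mono : ∀ s {f g : ℤ → ℕ} → (∀ y → f y ≤ g y) → ∀ x → walkSum s f x ≤ walkSum s g x
walkSum-mono zero f≤g x = f≤g x
walkSum-mono (suc s) f≤g x =
  +-mono-≤ (f≤g x) (+-mono-≤ (walkSum-mono s f≤g _) (walkSum-mono s f≤g _))

walkSum-cong : ∀ s {f g : ℤ → ℕ} → (∀ y → f y ≡ g y) → ∀ x → walkSum s f x ≡ walkSum s g x
walkSum-cong s f≡g x = ≤-antisym
  (walkSum-mono s (≤-reflexive ∘ f≡g) x) (walkSum-mono s (≤-reflexive ∘ sym ∘ f≡g) x)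

walkSum-+ : ∀ s (f g : ℤ → ℕ) x →
  walkSum s (λ y → f y + g y) x ≡ walkSum s f x + walkSum s g x
walkSum-+ zero f g x = refl
walkSum-+ (suc s) f g x
  rewrite walkSum-+ s f g (ℤ.suc x) | walkSum-+ s f g (ℤ.pred x) = regroup (f x) (g x)
      (walkSum s f (ℤ.suc x)) (walkSum s g (ℤ.suc x))
      (walkSum s f (ℤ.pred x)) (walkSum s g (ℤ.pred x))
  where
  regroup : ∀ u v w x y z → u + v + (w + x + (y + z)) ≡ u + (w + y) + (v + (x + z))
  regroup = solve-∀

walkSum-*ˡ : ∀ s c (f : ℤ → ℕ) x → walkSum s (λ y → c * f y) x ≡ c * walkSum s f x
walkSum-*ˡ zero c f x = refl
walkSum-*ˡ (suc s) c f x
  rewrite walkSum-*ˡ s c f (ℤ.suc x) | walkSum-*ˡ s c f (ℤ.pred x) =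
    factor c (f x) (walkSum s f (ℤ.suc x)) (walkSum s f (ℤ.pred x))
  where
  factor : ∀ c u v w → c * u + (c * v + c * w) ≡ c * (u + (v + w))
  factor = solve-∀

walkSum-*ʳ : ∀ s c (f : ℤ → ℕ) x → walkSum s (λ y → f y * c) x ≡ walkSum s f x * c
walkSum-*ʳ s c f x = begin
  walkSum s (λ y → f y * c) x ≡⟨ walkSum-cong s (λ y → *-comm (f y) c) x ⟩
  walkSum s (λ y → c * f y) x ≡⟨ walkSum-*ˡ s c f x ⟩
  c * walkSum s f x           ≡⟨ *-comm c _ ⟩
  walkSum s f x * c           ∎
  where open ≡-Reasoning

-- This is 2^(s+1) - 1, the number of walks with at most s steps and so of words of length at most
-- s.
size : ℕ → ℕ
size zero = 1
size (suc s) = 1 + (size s + size s)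

walkSum-const : ∀ s c x → walkSum s (λ _ → c) x ≡ c * size s
walkSum-const zero c x = sym (*-identityʳ c)
walkSum-const (suc s) c x
  rewrite walkSum-const s c (ℤ.suc x) | walkSum-const s c (ℤ.pred x) = factor c (size s)
  where
  factor : ∀ c n → c + (c * n + c * n) ≡ c * (1 + (n + n))
  factor = solve-∀

walkSum-1 : ∀ s x → walkSum s (λ _ → 1) x ≡ size s
walkSum-1 s x = trans (walkSum-const s 1 x) (*-identityˡ _)

walkSum-sumBelow : ∀ s n (f : ℕ → ℤ → ℕ) x →
  walkSum s (λ y → sumBelow n (λ k → f k y)) x ≡ sumBelow n (λ k → walkSum s (f k) x)
walkSum-sumBelow s zero f x = walkSum-const s 0 x
walkSum-sumBelow s (suc n) f x
  rewrite walkSum-+ s (λ y → sumBelow n (λ k → f k y)) (f n) x | walkSum-sumBelow s n f x = refl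

-- walkSum recurses on the first step of a walk; this is the recursion on the last one.
walkSum-last : ∀ s (f : ℤ → ℕ) x →
  walkSum (suc s) f x ≡ f x + walkSum s (λ y → f (ℤ.suc y) + f (ℤ.pred y)) x
walkSum-last zero f x = refl
walkSum-last (suc s) f x = begin
  f x + (walkSum (suc s) f (ℤ.suc x) + walkSum (suc s) f (ℤ.pred x))
    ≡⟨ cong (_+_ (f x)) (cong₂ _+_ (walkSum-last s f (ℤ.suc x)) (walkSum-last s f (ℤ.pred x))) ⟩
  f x + (f (ℤ.suc x) + walkSum s h (ℤ.suc x) + (f (ℤ.pred x) + walkSum s h (ℤ.pred x)))
    ≡⟨ cong (_+_ (f x))
         (regroup (f (ℤ.suc x)) (walkSum s h (ℤ.suc x)) (f (ℤ.pred x)) (walkSum s h (ℤ.pred x))) ⟩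
  f x + (f (ℤ.suc x) + f (ℤ.pred x) + (walkSum s h (ℤ.suc x) + walkSum s h (ℤ.pred x))) ∎
  where
  open ≡-Reasoning
  h : ℤ → ℕ
  h y = f (ℤ.suc y) + f (ℤ.pred y)
  regroup : ∀ w x y z → w + x + (y + z) ≡ w + y + (x + z)
  regroup = solve-∀

-- The reflection y ↦ c - y exchanges the two kinds of steps, so it maps the walks from x
-- bijectively to those from c - x.
walkSum-reflect : ∀ s (f : ℤ → ℕ) c x →
  walkSum s f (c ℤ.- x) ≡ walkSum s (λ y → f (c ℤ.- y)) x
walkSum-reflect zero f c x = refl
walkSum-reflect (suc s) f c x = cong (_+_ (f (c ℤ.- x))) (begin
  walkSum s f (ℤ.suc (c ℤ.- x)) + walkSum s f (ℤ.pred (c ℤ.- x))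
    ≡⟨ cong₂ (λ y z → walkSum s f y + walkSum s f z) (suc-minus c x) (pred-minus c x) ⟩
  walkSum s f (c ℤ.- ℤ.pred x) + walkSum s f (c ℤ.- ℤ.suc x)
    ≡⟨ +-comm (walkSum s f (c ℤ.- ℤ.pred x)) _ ⟩
  walkSum s f (c ℤ.- ℤ.suc x) + walkSum s f (c ℤ.- ℤ.pred x)
    ≡⟨ cong₂ _+_ (walkSum-reflect s f c (ℤ.suc x)) (walkSum-reflect s f c (ℤ.pred x)) ⟩
  walkSum s (λ y → f (c ℤ.- y)) (ℤ.suc x) + walkSum s (λ y → f (c ℤ.- y)) (ℤ.pred x) ∎)
  where
  open ≡-Reasoning
  suc-minus : ∀ c x → 1ℤ ℤ.+ (c ℤ.- x) ≡ c ℤ.- (ℤ.-1ℤ ℤ.+ x)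
  suc-minus = ℤ-Solver.solve-∀
  pred-minus : ∀ c x → ℤ.-1ℤ ℤ.+ (c ℤ.- x) ≡ c ℤ.- (1ℤ ℤ.+ x)
  pred-minus = ℤ-Solver.solve-∀

-- Walks are stopped when the comparison of the two sums is already known at
-- their position, for instance by reflection at the boundary of I.
walkSum-compare : ∀ {f g : ℤ → ℕ} (I : ℤ → Set) →
  (∀ {x} → I x → (∀ s → walkSum s f x ≤ walkSum s g x)
               ⊎ (f x ≤ g x × I (ℤ.suc x) × I (ℤ.pred x))) →
  ∀ s {x} → I x → walkSum s f x ≤ walkSum s g x
walkSum-compare I step s i with step i
... | inj₁ known = known s
walkSum-compare I step zero    i | inj₂ (f≤g , _ , _) = f≤g
walkSum-compare I step (suc s) i | inj₂ (f≤g , i₁ , i₂) =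
  +-mono-≤ f≤g (+-mono-≤ (walkSum-compare I step s i₁) (walkSum-compare I step s i₂))

-- Returns to 0 and absolute values of end points

isZero : ℤ → ℕ
isZero y = ⟦ y ℤ.≟ 0ℤ ⟧

isMultiple : ℕ → ℤ → ℕ
isMultiple d y = ⟦ + d ∣ℤ? y ⟧

returns : ℕ → ℕ
returns s = walkSum s isZero 0ℤ

walkSum-isZero-neg : ∀ s x → walkSum s isZero (0ℤ ℤ.- x) ≡ walkSum s isZero x
walkSum-isZero-neg s x = trans (walkSum-reflect s isZero 0ℤ x)
  (walkSum-cong s (λ y → ⟦⟧-cong (0ℤ ℤ.- y ℤ.≟ 0ℤ) (y ℤ.≟ 0ℤ) (to y) (from y)) x)
  where
  twice-neg : ∀ y → y ≡ 0ℤ ℤ.- (0ℤ ℤ.- y)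
  twice-neg = ℤ-Solver.solve-∀
  to : ∀ y → 0ℤ ℤ.- y ≡ 0ℤ → y ≡ 0ℤ
  to y e = trans (twice-neg y) (cong (λ z → 0ℤ ℤ.- z) e)
  from : ∀ y → y ≡ 0ℤ → 0ℤ ℤ.- y ≡ 0ℤ
  from y refl = refl

-- Under y ↦ 2 - y a walk from 2 to 0 becomes one from 0 to 2. It passes through 1, and reflecting
-- the rest of it there makes it end at 0.
walkSum-isZero-2≤returns : ∀ s → walkSum s isZero (+ 2) ≤ returns s
walkSum-isZero-2≤returns s = ≤-trans (≤-reflexive (walkSum-reflect s isZero (+ 2) 0ℤ))
  (walkSum-compare (λ y → y ℤ.≤ 1ℤ) step s (ℤ.+≤+ z≤n))
  where
  f : ℤ → ℕ
  f y = isZero (+ 2 ℤ.- y)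
  f-below : ∀ {x} → x ℤ.≤ 0ℤ → f x ≡ 0
  f-below {+ zero} _ = refl
  f-below { -[1+ n ]} _ = refl
  f-below {+ suc n} (ℤ.+≤+ ())
  step : ∀ {x} → x ℤ.≤ 1ℤ → (∀ s → walkSum s f x ≤ walkSum s isZero x)
       ⊎ (f x ≤ isZero x × ℤ.suc x ℤ.≤ 1ℤ × ℤ.pred x ℤ.≤ 1ℤ)
  step {x} x≤1 with x ℤ.≟ 1ℤ
  ... | yes refl = inj₁ (λ s → ≤-reflexive (sym (walkSum-reflect s isZero (+ 2) 1ℤ)))
  ... | no x≢1 = inj₂
    ( ≤-trans (≤-reflexive (f-below (ℤₚ.i<j⇒i≤pred[j] x<1))) z≤n
    , ℤₚ.i<j⇒suc[i]≤j x<1 , ℤₚ.i≤j⇒pred[i]≤j x≤1 )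
    where x<1 = ℤₚ.≤∧≢⇒< x≤1 x≢1

-- The first two steps lead to 2, to -2 or, in two ways, back to 0; from 2 or -2 no more walks end
-- at 0 than from 0. The 1 counts the empty walk.
returns-step : ∀ s → returns (2 + s) ≤ 1 + 4 * returns s
returns-step s = begin
  1 + (walkSum (suc s) isZero (+ 1) + walkSum (suc s) isZero -[1+ 0 ])
    ≡⟨⟩
  1 + (walkSum s isZero (+ 2) + returns s + (returns s + walkSum s isZero -[1+ 1 ]))
    ≡⟨ cong (λ w → 1 + (walkSum s isZero (+ 2) + returns s + (returns s + w)))
         (walkSum-isZero-neg s (+ 2)) ⟩
  1 + (walkSum s isZero (+ 2) + returns s + (returns s + walkSum s isZero (+ 2)))
    ≤⟨ s≤s (+-mono-≤ (+-monoˡ-≤ _ le) (+-monoʳ-≤ _ le)) ⟩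
  1 + (returns s + returns s + (returns s + returns s))
    ≡⟨ collect (returns s) ⟩
  1 + 4 * returns s ∎
  where
  open ≤-Reasoning
  le = walkSum-isZero-2≤returns s
  collect : ∀ g → 1 + (g + g + (g + g)) ≡ 1 + 4 * g
  collect = solve-∀

-- The empty walk and the walks whose first two steps lead back to 0 suffice.
returns-grow : ∀ s → 1 + 2 * returns s ≤ returns (2 + s)
returns-grow s = s≤s (≤-trans (≤-reflexive (collect (returns s)))
  (+-mono-≤ (m≤n+m _ (walkSum s isZero (+ 2))) (m≤m+n _ _)))
  where
  collect : ∀ g → 2 * g ≡ g + g
  collect = solve-∀

absSum : ℕ → ℕ
absSum s = walkSum s ℤ.∣_∣ 0ℤ

-- The absolute value is harmonic except at 0. This ties the growth of `absSum` to the number of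
-- returns, as in a discrete Tanaka formula.
∣suc∣+∣pred∣ : ∀ y → ℤ.∣ ℤ.suc y ∣ + ℤ.∣ ℤ.pred y ∣ ≡ 2 * ℤ.∣ y ∣ + 2 * isZero y
∣suc∣+∣pred∣ (+ zero) = refl
∣suc∣+∣pred∣ (+ suc n) = collect n
  where
  collect : ∀ n → 2 + n + n ≡ 2 * suc n + 0
  collect = solve-∀
∣suc∣+∣pred∣ -[1+ zero ] = refl
∣suc∣+∣pred∣ -[1+ suc n ] = collect n
  where
  collect : ∀ n → suc n + suc (suc (suc n)) ≡ 2 * suc (suc n) + 0
  collect = solve-∀

absSum-suc : ∀ s → absSum (suc s) ≡ 2 * absSum s + 2 * returns s
absSum-suc s = begin
  absSum (suc s)
    ≡⟨ walkSum-last s ℤ.∣_∣ 0ℤ ⟩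
  walkSum s (λ y → ℤ.∣ ℤ.suc y ∣ + ℤ.∣ ℤ.pred y ∣) 0ℤ
    ≡⟨ walkSum-cong s ∣suc∣+∣pred∣ 0ℤ ⟩
  walkSum s (λ y → 2 * ℤ.∣ y ∣ + 2 * isZero y) 0ℤ
    ≡⟨ walkSum-+ s _ _ 0ℤ ⟩
  walkSum s (λ y → 2 * ℤ.∣ y ∣) 0ℤ + walkSum s (λ y → 2 * isZero y) 0ℤ
    ≡⟨ cong₂ _+_ (walkSum-*ˡ s 2 ℤ.∣_∣ 0ℤ) (walkSum-*ˡ s 2 isZero 0ℤ) ⟩
  2 * absSum s + 2 * returns s ∎
  where open ≡-Reasoning

-- Parity, returns to 0 and divisibility of end points

isEven isOdd : ℤ → ℕ
isEven = isMultiple 2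
isOdd y = isEven (ℤ.suc y)

isMultiple-shift : ∀ d y k {z} → z ≡ y ℤ.+ k ℤ.* + d → isMultiple d z ≡ isMultiple d y
isMultiple-shift d y k {z} e = ⟦⟧-cong (+ d ∣ℤ? z) (+ d ∣ℤ? y)
  (λ d∣z → ℤ∣.∣m+n∣n⇒∣m (subst (_ ∣ℤ_) e d∣z) (ℤ∣.divides k refl))
  (λ d∣y → subst (_ ∣ℤ_) (sym e) (ℤ∣.∣m∣n⇒∣m+n d∣y (ℤ∣.divides k refl)))

evens odds : ℕ → ℕ
evens s = walkSum s isEven 0ℤ
odds s = walkSum s isOdd 0ℤ

-- The last step changes the parity; the 1 is the empty walk.
evens-suc : ∀ s → evens (suc s) ≡ 1 + 2 * odds s
evens-suc s = begin
  evens (suc s)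
    ≡⟨ walkSum-last s isEven 0ℤ ⟩
  1 + walkSum s (λ y → isOdd y + isEven (ℤ.pred y)) 0ℤ
    ≡⟨ cong suc (walkSum-cong s step 0ℤ) ⟩
  1 + walkSum s (λ y → 2 * isOdd y) 0ℤ
    ≡⟨ cong suc (walkSum-*ˡ s 2 isOdd 0ℤ) ⟩
  1 + 2 * odds s ∎
  where
  open ≡-Reasoning
  shift : ∀ y → ℤ.-1ℤ ℤ.+ y ≡ (1ℤ ℤ.+ y) ℤ.+ ℤ.-1ℤ ℤ.* + 2
  shift = ℤ-Solver.solve-∀
  step : ∀ y → isOdd y + isEven (ℤ.pred y) ≡ 2 * isOdd y
  step y = cong (_+_ (isOdd y)) (trans (isMultiple-shift 2 (ℤ.suc y) ℤ.-1ℤ (shift y)) (sym (+-identityʳ _)))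

odds-suc : ∀ s → odds (suc s) ≡ 2 * evens s
odds-suc s = begin
  odds (suc s)
    ≡⟨ walkSum-last s isOdd 0ℤ ⟩
  walkSum s (λ y → isOdd (ℤ.suc y) + isOdd (ℤ.pred y)) 0ℤ
    ≡⟨ walkSum-cong s step 0ℤ ⟩
  walkSum s (λ y → 2 * isEven y) 0ℤ
    ≡⟨ walkSum-*ˡ s 2 isEven 0ℤ ⟩
  2 * evens s ∎
  where
  open ≡-Reasoning
  shift : ∀ y → 1ℤ ℤ.+ (1ℤ ℤ.+ y) ≡ y ℤ.+ 1ℤ ℤ.* + 2
  shift = ℤ-Solver.solve-∀
  step : ∀ y → isOdd (ℤ.suc y) + isOdd (ℤ.pred y) ≡ 2 * isEven y
  step y = cong₂ _+_ (isMultiple-shift 2 y 1ℤ (shift y))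
    (trans (cong isEven (ℤₚ.suc-pred y)) (sym (+-identityʳ _)))

size≡evens+odds : ∀ s → size s ≡ evens s + odds s
size≡evens+odds zero = refl
size≡evens+odds (suc s) = begin
  1 + (size s + size s)                          ≡⟨ cong (λ n → 1 + (n + n)) (size≡evens+odds s) ⟩
  1 + (evens s + odds s + (evens s + odds s))    ≡⟨ collect (evens s) (odds s) ⟩
  1 + 2 * odds s + 2 * evens s                   ≡⟨ cong₂ _+_ (evens-suc s) (odds-suc s) ⟨
  evens (suc s) + odds (suc s)                   ∎
  where
  open ≡-Reasoning
  collect : ∀ e o → 1 + (e + o + (e + o)) ≡ 1 + 2 * o + 2 * e
  collect = solve-∀

-- Each positive even number of steps allows twice as many walks as the odd number before it; the
-- empty walk is left over.
evens≡1+2odds : ∀ n → evens (n * 2) ≡ 1 + 2 * odds (n * 2)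
evens≡1+2odds zero = refl
evens≡1+2odds (suc n) = begin
  evens (2 + n * 2)               ≡⟨ evens-suc (1 + n * 2) ⟩
  1 + 2 * odds (1 + n * 2)        ≡⟨ cong (λ o → 1 + 2 * o) (odds-suc (n * 2)) ⟩
  1 + 2 * (2 * evens (n * 2))     ≡⟨ cong (λ e → 1 + 2 * (2 * e)) (evens≡1+2odds n) ⟩
  1 + 2 * (2 * (1 + 2 * odds (n * 2))) ≡⟨ cong (λ e → 1 + 2 * (2 * e)) (evens-suc (n * 2)) ⟨
  1 + 2 * (2 * evens (1 + n * 2)) ≡⟨ cong (λ o → 1 + 2 * o) (odds-suc (1 + n * 2)) ⟨
  1 + 2 * odds (2 + n * 2)        ∎
  where open ≡-Reasoning

-- Up to an odd bound the lengths 2k and 2k + 1 come in pairs, the second with twice as many walks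
-- as the first.
size≡3evens : ∀ n → size (1 + n * 2) ≡ 3 * evens (1 + n * 2)
size≡3evens n = trans (size≡evens+odds (1 + n * 2)) (trans
  (cong (_+_ (evens (1 + n * 2))) (trans (odds-suc (n * 2))
    (cong (λ e → 2 * e) (trans (evens≡1+2odds n) (sym (evens-suc (n * 2)))))))
  (triple (evens (1 + n * 2))))
  where
  triple : ∀ e → e + 2 * e ≡ 3 * e
  triple = solve-∀

walkSum-suc-≤ : ∀ s f x → walkSum s f x ≤ walkSum (suc s) f x
walkSum-suc-≤ zero f x = m≤m+n _ _
walkSum-suc-≤ (suc s) f x =
  +-monoʳ-≤ (f x) (+-mono-≤ (walkSum-suc-≤ s f (ℤ.suc x)) (walkSum-suc-≤ s f (ℤ.pred x)))

-- A crude bound, good enough to absorb the summand `suc n` in the induction step of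
-- `n*returns≤absSum`.
n<returns : ∀ n → n < returns (n * 2)
n<returns zero = s≤s z≤n
n<returns (suc n) = begin
  2 + n                  ≤⟨ s≤s (n<returns n) ⟩
  1 + returns (n * 2)     ≤⟨ s≤s (m≤m+n _ _) ⟩
  1 + 2 * returns (n * 2) ≤⟨ returns-grow (n * 2) ⟩
  returns (suc n * 2)     ∎
  where open ≤-Reasoning

-- Two steps multiply both sums by about 4, but by `absSum-suc` the absolute sum also gains about 4
-- times the number of returns. So n pairs of steps collect n copies of the current number of
-- returns.
n*returns≤absSum : ∀ n → n * returns (n * 2) ≤ absSum (n * 2)
n*returns≤absSum zero = z≤n
n*returns≤absSum (suc n) = begin
  suc n * returns (2 + n * 2)           ≤⟨ *-monoʳ-≤ (suc n) (returns-step (n * 2)) ⟩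
  suc n * (1 + 4 * G)                   ≡⟨ expand n G ⟩
  4 * (n * G) + 4 * G + suc n           ≤⟨ +-mono-≤ (+-monoˡ-≤ (4 * G) (*-monoʳ-≤ 4 (n*returns≤absSum n)))
                                             (≤-trans (n<returns n)
                                               (≤-trans (walkSum-suc-≤ (n * 2) isZero 0ℤ) (m≤m+n _ _))) ⟩
  4 * A + 4 * G + 2 * returns (1 + n * 2) ≡⟨ cong (λ w → w + 2 * returns (1 + n * 2)) (regroup A G) ⟩
  2 * (2 * A + 2 * G) + 2 * returns (1 + n * 2)
    ≡⟨ cong (λ w → 2 * w + 2 * returns (1 + n * 2)) (absSum-suc (n * 2)) ⟨
  2 * absSum (1 + n * 2) + 2 * returns (1 + n * 2) ≡⟨ absSum-suc (1 + n * 2) ⟨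
  absSum (2 + n * 2) ∎
  where
  open ≤-Reasoning
  G = returns (n * 2)
  A = absSum (n * 2)
  expand : ∀ n g → suc n * (1 + 4 * g) ≡ 4 * (n * g) + 4 * g + suc n
  expand = solve-∀
  regroup : ∀ x g → 4 * x + 4 * g ≡ 2 * (2 * x + 2 * g)
  regroup = solve-∀

absSq : ℤ → ℕ
absSq y = ℤ.∣ y ∣ * ℤ.∣ y ∣

absSq-suc+pred : ∀ y → absSq (ℤ.suc y) + absSq (ℤ.pred y) ≡ 2 * absSq y + 2
absSq-suc+pred (+ zero) = refl
absSq-suc+pred (+ suc n) = expand n
  where
  expand : ∀ n → (2 + n) * (2 + n) + n * n ≡ 2 * ((1 + n) * (1 + n)) + 2
  expand = solve-∀
absSq-suc+pred -[1+ zero ] = refl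
absSq-suc+pred -[1+ suc n ] = expand n
  where
  expand : ∀ n → (1 + n) * (1 + n) + (3 + n) * (3 + n) ≡ 2 * ((2 + n) * (2 + n)) + 2
  expand = solve-∀

-- Every step raises the mean of y² by 1, and no walk has more than s steps.
walkSum-absSq : ∀ s x → walkSum s absSq x ≤ (absSq x + s) * size s
walkSum-absSq zero x = ≤-reflexive (sym (trans (*-identityʳ _) (+-identityʳ _)))
walkSum-absSq (suc s) x = begin
  q + (walkSum s absSq (ℤ.suc x) + walkSum s absSq (ℤ.pred x))
    ≤⟨ +-monoʳ-≤ q (+-mono-≤ (walkSum-absSq s (ℤ.suc x)) (walkSum-absSq s (ℤ.pred x))) ⟩
  q + ((q₁ + s) * size s + (q₂ + s) * size s)
    ≡⟨ cong (_+_ q) (collect q₁ q₂ s (size s)) ⟩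
  q + (q₁ + q₂ + 2 * s) * size s
    ≡⟨ cong (λ w → q + (w + 2 * s) * size s) (absSq-suc+pred x) ⟩
  q + (2 * q + 2 + 2 * s) * size s
    -- The slack comes from the empty walk, which stays at x.
    ≤⟨ m≤m+n _ (suc s) ⟩
  q + (2 * q + 2 + 2 * s) * size s + suc s
    ≡⟨ expand q s (size s) ⟩
  (q + suc s) * size (suc s) ∎
  where
  open ≤-Reasoning
  q = absSq x
  q₁ = absSq (ℤ.suc x)
  q₂ = absSq (ℤ.pred x)
  collect : ∀ u v s n → (u + s) * n + (v + s) * n ≡ (u + v + 2 * s) * n
  collect = solve-∀
  expand : ∀ q s n → q + (2 * q + 2 + 2 * s) * n + suc s ≡ (q + suc s) * (1 + (n + n))
  expand = solve-∀

-- The two sides differ by (m - n)², so the induction may lower both arguments at once and needs no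
-- subtraction.
2mn≤m²+n² : ∀ m n → 2 * (m * n) ≤ m * m + n * n
2mn≤m²+n² zero n = z≤n
2mn≤m²+n² (suc m) zero rewrite *-zeroʳ m = z≤n
2mn≤m²+n² (suc m) (suc n) = begin
  2 * (suc m * suc n)                     ≡⟨ expand m n ⟩
  2 * (m * n) + (2 * m + 2 * n + 2)        ≤⟨ +-monoˡ-≤ _ (2mn≤m²+n² m n) ⟩
  m * m + n * n + (2 * m + 2 * n + 2)      ≡⟨ collect m n ⟩
  suc m * suc m + suc n * suc n            ∎
  where
  open ≤-Reasoning
  expand : ∀ m n → 2 * (suc m * suc n) ≡ 2 * (m * n) + (2 * m + 2 * n + 2)
  expand = solve-∀
  collect : ∀ m n → m * m + n * n + (2 * m + 2 * n + 2) ≡ suc m * suc m + suc n * suc n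
  collect = solve-∀

-- A substitute for Cauchy-Schwarz without square roots: 2t|y| ≤ t² + y², where t is to be chosen
-- near √s.
absSum-bound : ∀ t s → 2 * t * absSum s ≤ (t * t + s) * size s
absSum-bound t s = begin
  2 * t * absSum s
    ≡⟨ walkSum-*ˡ s (2 * t) ℤ.∣_∣ 0ℤ ⟨
  walkSum s (λ y → 2 * t * ℤ.∣ y ∣) 0ℤ
    ≤⟨ walkSum-mono s (λ y → ≤-trans (≤-reflexive (*-assoc 2 t ℤ.∣ y ∣)) (2mn≤m²+n² t ℤ.∣ y ∣)) 0ℤ ⟩
  walkSum s (λ y → t * t + absSq y) 0ℤ
    ≡⟨ walkSum-+ s (λ _ → t * t) absSq 0ℤ ⟩
  walkSum s (λ _ → t * t) 0ℤ + walkSum s absSq 0ℤ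
    ≤⟨ +-mono-≤ (≤-reflexive (walkSum-const s (t * t) 0ℤ)) (walkSum-absSq s 0ℤ) ⟩
  t * t * size s + s * size s
    ≡⟨ *-distribʳ-+ (size s) (t * t) s ⟨
  (t * t + s) * size s ∎
  where open ≤-Reasoning

1≤size : ∀ s → 1 ≤ size s
1≤size zero = s≤s z≤n
1≤size (suc s) = s≤s z≤n

-- The walks are prolonged to the even length s + 1 = 4r², a perfect square. There the two bounds on
-- `absSum` squeeze the number of returns to at most `size` / r; the 3 comes from going back to
-- `size s`.
returns-bound : ∀ r m → suc m ≡ 2 * (r * r) →
  r * returns (1 + m * 2) ≤ 3 * size (1 + m * 2)
returns-bound zero m ()
returns-bound r@(suc _) m 1+m≡2r² = begin
  r * returns (1 + m * 2)  ≤⟨ *-monoʳ-≤ r (walkSum-suc-≤ (1 + m * 2) isZero 0ℤ) ⟩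
  r * G                    ≤⟨ *-cancelˡ-≤ (8 * (r * r)) cubic ⟩
  size (suc m * 2)         ≤⟨ +-monoˡ-≤ _ (1≤size (1 + m * 2)) ⟩
  N + (N + N)              ≡⟨ triple N ⟩
  3 * N                    ∎
  where
  open ≤-Reasoning
  N = size (1 + m * 2)
  G = returns (suc m * 2)
  triple : ∀ n → n + (n + n) ≡ 3 * n
  triple = solve-∀
  expand : ∀ r g → 8 * (r * r) * (r * g) ≡ 4 * r * (2 * (r * r) * g)
  expand = solve-∀
  assoc : ∀ r x → 4 * r * x ≡ 2 * (2 * r) * x
  assoc = solve-∀
  collect : ∀ r n → (2 * r * (2 * r) + 2 * (r * r) * 2) * n ≡ 8 * (r * r) * n
  collect = solve-∀
  cubic : 8 * (r * r) * (r * G) ≤ 8 * (r * r) * size (suc m * 2)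
  cubic = begin
    8 * (r * r) * (r * G)         ≡⟨ expand r G ⟩
    4 * r * (2 * (r * r) * G)     ≡⟨ cong (λ w → 4 * r * (w * G)) 1+m≡2r² ⟨
    4 * r * (suc m * G)           ≤⟨ *-monoʳ-≤ (4 * r) (n*returns≤absSum (suc m)) ⟩
    4 * r * absSum (suc m * 2)    ≡⟨ assoc r (absSum (suc m * 2)) ⟩
    -- The choice t = 2r makes t² equal to the number 4r² of steps.
    2 * (2 * r) * absSum (suc m * 2) ≤⟨ absSum-bound (2 * r) (suc m * 2) ⟩
    (2 * r * (2 * r) + suc m * 2) * size (suc m * 2)
      ≡⟨ cong (λ w → (2 * r * (2 * r) + w * 2) * size (suc m * 2)) 1+m≡2r² ⟩
    (2 * r * (2 * r) + 2 * (r * r) * 2) * size (suc m * 2)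
      ≡⟨ collect r (size (suc m * 2)) ⟩
    8 * (r * r) * size (suc m * 2) ∎

multiples : ℕ → ℕ → ℕ
multiples d s = walkSum s (isMultiple d) 0ℤ

-- A walk from 0 that returns to a nonzero multiple of d has visited j or j - d;
-- reflecting the rest of it there makes it end at 2j modulo d.
multiples≤ : ∀ s d j → j ≤ d →
  multiples d s ≤ returns s + walkSum s (λ y → isMultiple d (y ℤ.- + 2 ℤ.* + j)) 0ℤ
multiples≤ s d j j≤d = begin
  multiples d s                              ≤⟨ walkSum-mono s split 0ℤ ⟩
  walkSum s (λ y → isZero y + f y) 0ℤ         ≡⟨ walkSum-+ s isZero f 0ℤ ⟩
  returns s + walkSum s f 0ℤ                  ≤⟨ +-monoʳ-≤ (returns s) (walkSum-compare I step s
                                                  (ℤₚ.i≤j⇒i-j≤0 (ℤ.+≤+ j≤d) , ℤ.+≤+ z≤n)) ⟩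
  returns s + walkSum s g 0ℤ                  ∎
  where
  open ≤-Reasoning
  nonzeroMultiple? : ∀ y → Dec (+ d ∣ℤ y × y ≢ 0ℤ)
  nonzeroMultiple? y = (+ d ∣ℤ? y) ×-dec ¬? (y ℤ.≟ 0ℤ)
  f g : ℤ → ℕ
  f y = ⟦ nonzeroMultiple? y ⟧
  g y = isMultiple d (y ℤ.- + 2 ℤ.* + j)
  I : ℤ → Set
  I x = + j ℤ.- + d ℤ.≤ x × x ℤ.≤ + j
  split : ∀ y → isMultiple d y ≤ isZero y + f y
  split y with y ℤ.≟ 0ℤ
  ... | yes _ = ≤-trans (⟦⟧≤1 (+ d ∣ℤ? y)) (m≤m+n 1 _)
  ... | no y≢0 = ⟦⟧-mono (+ d ∣ℤ? y) ((+ d ∣ℤ? y) ×-dec yes y≢0) (λ d∣y → d∣y , y≢0)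
  reflected : ∀ c x → x ≡ c ℤ.- x → (∀ y → + d ∣ℤ y → + d ∣ℤ ((c ℤ.- y) ℤ.- + 2 ℤ.* + j)) →
    ∀ s → walkSum s f x ≤ walkSum s g x
  reflected c x fixed implies s = begin
    walkSum s f x ≤⟨ walkSum-mono s (λ y → ⟦⟧-mono (nonzeroMultiple? y)
                       (+ d ∣ℤ? ((c ℤ.- y) ℤ.- + 2 ℤ.* + j)) (implies y ∘ proj₁)) x ⟩
    walkSum s (λ y → g (c ℤ.- y)) x ≡⟨ walkSum-reflect s g c x ⟨
    walkSum s g (c ℤ.- x)           ≡⟨ cong (walkSum s g) fixed ⟨
    walkSum s g x                   ∎
  -- Strictly between j - d and j the absolute value is below d, so 0 is the only possible multiple
  -- of d.
  f-inside : ∀ x → + j ℤ.- + d ℤ.< x → x ℤ.< + j → f x ≡ 0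
  f-inside x lo<x x<hi = ⟦⟧-no (nonzeroMultiple? x) (λ (d∣x , x≢0) → absurd x lo<x x<hi
    (ℕ∣.∣⇒≤ {{ℕ.≢-nonZero (x≢0 ∘ ℤₚ.∣i∣≡0⇒i≡0)}} (ℤ∣.∣⇒∣ᵤ d∣x)))
    where
    absurd : ∀ x → + j ℤ.- + d ℤ.< x → x ℤ.< + j → d ≤ ℤ.∣ x ∣ → ⊥
    absurd (+ n) _ (ℤ.+<+ n<j) d≤n = <-irrefl refl (<-≤-trans n<j (≤-trans j≤d d≤n))
    absurd x@(-[1+ n ]) lo<x _ d≤1+n = ℤₚ.<-irrefl refl (ℤₚ.<-≤-trans lo<x
      (ℤₚ.≤-trans (ℤₚ.neg-mono-≤ (ℤ.+≤+ d≤1+n))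
        (ℤₚ.≤-trans (ℤₚ.≤-reflexive (sym (ℤₚ.+-identityˡ _))) (ℤₚ.+-monoˡ-≤ (ℤ.- + d) (ℤ.+≤+ {0} {j} z≤n)))))
  step : ∀ {x} → I x → (∀ s → walkSum s f x ≤ walkSum s g x)
       ⊎ (f x ≤ g x × I (ℤ.suc x) × I (ℤ.pred x))
  step {x} (lo≤x , x≤hi) with x ℤ.≟ + j | + j ℤ.- + d ℤ.≟ x
  ... | yes refl | _ = inj₁ (reflected (+ 2 ℤ.* + j) (+ j) (double (+ j))
    (λ y d∣y → subst (_ ∣ℤ_) (negate (+ j) y) (ℤ∣.∣m⇒∣-m d∣y)))
    where
    double : ∀ j → j ≡ + 2 ℤ.* j ℤ.- j
    double = ℤ-Solver.solve-∀
    negate : ∀ j y → ℤ.- y ≡ + 2 ℤ.* j ℤ.- y ℤ.- + 2 ℤ.* j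
    negate = ℤ-Solver.solve-∀
  -- Reflecting at j - d sends y to 2j - 2d - y, the same class modulo d as 2j - y.
  ... | no _ | yes refl = inj₁ (reflected (+ 2 ℤ.* (+ j ℤ.- + d)) (+ j ℤ.- + d) (double (+ j ℤ.- + d))
    (λ y d∣y → subst (_ ∣ℤ_) (negate (+ j) (+ d) y)
      (ℤ∣.∣m∣n⇒∣m+n (ℤ∣.∣m⇒∣-m d∣y) (ℤ∣.divides (ℤ.- + 2) refl))))
    where
    double : ∀ j → j ≡ + 2 ℤ.* j ℤ.- j
    double = ℤ-Solver.solve-∀
    negate : ∀ j d y → ℤ.- y ℤ.+ ℤ.- + 2 ℤ.* d ≡ + 2 ℤ.* (j ℤ.- d) ℤ.- y ℤ.- + 2 ℤ.* j
    negate = ℤ-Solver.solve-∀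
  ... | no x≢hi | no lo≢x = inj₂
    ( ≤-trans (≤-reflexive (f-inside x lo<x x<hi)) z≤n
    , (ℤₚ.i≤j⇒i≤1+j lo≤x , ℤₚ.i<j⇒suc[i]≤j x<hi)
    , (ℤₚ.i<j⇒i≤pred[j] lo<x , ℤₚ.i≤j⇒pred[i]≤j x≤hi) )
    where
    lo<x = ℤₚ.≤∧≢⇒< lo≤x lo≢x
    x<hi = ℤₚ.≤∧≢⇒< x≤hi x≢hi

-- Sum `multiples≤` over all j < d. As d is odd, the residues 2j are distinct modulo d, so every end
-- point is counted at most once.
multiples-bound : ∀ s m → let d = 1 + 2 * m in
  d * multiples d s ≤ d * returns s + size s
multiples-bound s m = begin
  d * multiples d s
    ≡⟨ sumBelow-const d (multiples d s) ⟨
  sumBelow d (λ _ → multiples d s)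
    ≤⟨ sumBelow-mono d (λ {j} j<d → multiples≤ s d j (<⇒≤ j<d)) ⟩
  sumBelow d (λ j → returns s + walkSum s (g j) 0ℤ)
    ≡⟨ sumBelow-+ d (λ _ → returns s) _ ⟩
  sumBelow d (λ _ → returns s) + sumBelow d (λ j → walkSum s (g j) 0ℤ)
    ≡⟨ cong₂ _+_ (sumBelow-const d (returns s)) (sym (walkSum-sumBelow s d g 0ℤ)) ⟩
  d * returns s + walkSum s (λ y → sumBelow d (λ j → g j y)) 0ℤ
    ≤⟨ +-monoʳ-≤ (d * returns s) (walkSum-mono s residue-unique 0ℤ) ⟩
  d * returns s + walkSum s (λ _ → 1) 0ℤ
    ≡⟨ cong (_+_ (d * returns s)) (walkSum-1 s 0ℤ) ⟩
  d * returns s + size s ∎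
  where
  open ≤-Reasoning
  d = 1 + 2 * m
  g : ℕ → ℤ → ℕ
  g j y = isMultiple d (y ℤ.- + 2 ℤ.* + j)
  +d≡ : + d ≡ 1ℤ ℤ.+ + 2 ℤ.* + m
  +d≡ = cong (λ z → 1ℤ ℤ.+ z) (ℤₚ.pos-* 2 m)
  residue-unique : ∀ y → sumBelow d (λ j → g j y) ≤ 1
  residue-unique y = sumBelow-unique d (λ j → + d ∣ℤ? (y ℤ.- + 2 ℤ.* + j)) distinct-residues
    where
    distinct-residues : ∀ {i j} → i < j → j < d →
      + d ∣ℤ (y ℤ.- + 2 ℤ.* + i) → + d ∣ℤ (y ℤ.- + 2 ℤ.* + j) → ⊥
    distinct-residues {i} {j} i<j j<d d∣yi d∣yj =
      ℕ∣.>⇒∤ {{ℕ.>-nonZero (m<n⇒0<n∸m i<j)}} (≤-<-trans (m∸n≤m j i) j<d) (ℤ∣.∣⇒∣ᵤ d∣k)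
      where
      k = j ∸ i
      halve : ∀ m k → (1ℤ ℤ.+ + 2 ℤ.* m) ℤ.* k ℤ.- m ℤ.* (+ 2 ℤ.* k) ≡ k
      halve = ℤ-Solver.solve-∀
      difference : ∀ y i k → (y ℤ.- + 2 ℤ.* i) ℤ.- (y ℤ.- + 2 ℤ.* (i ℤ.+ k)) ≡ + 2 ℤ.* k
      difference = ℤ-Solver.solve-∀
      d∣2k : + d ∣ℤ (+ 2 ℤ.* + k)
      d∣2k = subst (_ ∣ℤ_)
        (trans (cong (λ j → (y ℤ.- + 2 ℤ.* + i) ℤ.- (y ℤ.- + 2 ℤ.* + j)) (sym (m+[n∸m]≡n (<⇒≤ i<j))))
          (difference y (+ i) (+ k)))
        (ℤ∣.∣m∣n⇒∣m-n d∣yi d∣yj)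
      -- Halving modulo d: since d - 2m = 1, the number k is d k - m (2k).
      d∣k : + d ∣ℤ + k
      d∣k = subst (_ ∣ℤ_) (trans (cong (λ d → d ℤ.* + k ℤ.- + m ℤ.* (+ 2 ℤ.* + k)) +d≡) (halve (+ m) (+ k)))
        (ℤ∣.∣m∣n⇒∣m-n (ℤ∣.∣m⇒∣m*n (+ k) ℤ∣.∣-refl) (ℤ∣.∣n⇒∣m*n (+ m) d∣2k))

-- Σ 1/((k+1)(k+2)) telescopes to less than 1.
telescope : ∀ T (e : ℕ → ℕ) → (∀ k → e k * ((1 + k) * (2 + k)) ≤ T) → ∀ n → sumBelow n e ≤ T
telescope T e bound n = *-cancelˡ-≤ (suc n) (≤-trans (scaled n) (*-monoˡ-≤ T (n≤1+n n)))
  where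
  open ≤-Reasoning
  expand : ∀ n E x → (1 + n) * ((2 + n) * (E + x)) ≡ (2 + n) * ((1 + n) * E) + x * ((1 + n) * (2 + n))
  expand = solve-∀
  collect : ∀ n T → (2 + n) * (n * T) + T ≡ (1 + n) * ((1 + n) * T)
  collect = solve-∀
  -- The first n terms of the series add up to n/(n+1).
  scaled : ∀ n → suc n * sumBelow n e ≤ n * T
  scaled zero = z≤n
  scaled (suc n) = *-cancelˡ-≤ (suc n) (begin
    (1 + n) * ((2 + n) * (sumBelow n e + e n))
      ≡⟨ expand n (sumBelow n e) (e n) ⟩
    (2 + n) * ((1 + n) * sumBelow n e) + e n * ((1 + n) * (2 + n))
      ≤⟨ +-mono-≤ (*-monoʳ-≤ (2 + n) (scaled n)) (bound n) ⟩
    (2 + n) * (n * T) + T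
      ≡⟨ collect n T ⟩
    (1 + n) * ((1 + n) * T) ∎)

-- Coprime pairs of end points

coprime? : ∀ x y → Dec (gcd ℤ.∣ x ∣ ℤ.∣ y ∣ ≡ 1)
coprime? x y = gcd ℤ.∣ x ∣ ℤ.∣ y ∣ ≟ 1

isCoprime : ℤ → ℤ → ℕ
isCoprime x y = ⟦ coprime? x y ⟧

isMultiple-yes : ∀ {d} y → d ℕ∣.∣ ℤ.∣ y ∣ → isMultiple d y ≡ 1
isMultiple-yes {d} y d∣y = ⟦⟧-yes (+ d ∣ℤ? y) (ℤ∣.∣ᵤ⇒∣ d∣y)

pairSum : ℕ → (ℤ → ℤ → ℕ) → ℕ
pairSum s f = walkSum s (λ x → walkSum s (f x) 0ℤ) 0ℤ

pairSum-mono : ∀ s {f g : ℤ → ℤ → ℕ} → (∀ x y → f x y ≤ g x y) → pairSum s f ≤ pairSum s g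
pairSum-mono s f≤g = walkSum-mono s (λ x → walkSum-mono s (f≤g x) 0ℤ) 0ℤ

pairSum-+ : ∀ s (f g : ℤ → ℤ → ℕ) →
  pairSum s (λ x y → f x y + g x y) ≡ pairSum s f + pairSum s g
pairSum-+ s f g =
  trans (walkSum-cong s (λ x → walkSum-+ s (f x) (g x) 0ℤ) 0ℤ) (walkSum-+ s _ _ 0ℤ)

pairSum-* : ∀ s (f g : ℤ → ℕ) →
  pairSum s (λ x y → f x * g y) ≡ walkSum s f 0ℤ * walkSum s g 0ℤ
pairSum-* s f g =
  trans (walkSum-cong s (λ x → walkSum-*ˡ s (f x) g 0ℤ) 0ℤ) (walkSum-*ʳ s _ f 0ℤ)

pairSum-fst : ∀ s (f : ℤ → ℕ) → pairSum s (λ x _ → f x) ≡ walkSum s f 0ℤ * size s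
pairSum-fst s f =
  trans (walkSum-cong s (λ x → walkSum-const s (f x) 0ℤ) 0ℤ) (walkSum-*ʳ s (size s) f 0ℤ)

pairSum-sumBelow : ∀ s n (f : ℕ → ℤ → ℤ → ℕ) →
  pairSum s (λ x y → sumBelow n (λ k → f k x y)) ≡ sumBelow n (λ k → pairSum s (f k))
pairSum-sumBelow s n f =
  trans (walkSum-cong s (λ x → walkSum-sumBelow s n (λ k → f k x) 0ℤ) 0ℤ)
    (walkSum-sumBelow s n (λ k x → walkSum s (f k x) 0ℤ) 0ℤ)

coprimePairs : ℕ → ℕ
coprimePairs s = pairSum s isCoprime

pairSum-1 : ∀ s → pairSum s (λ _ _ → 1) ≡ size s * size s
pairSum-1 s = trans (pairSum-fst s (λ _ → 1)) (cong (λ n → n * size s) (walkSum-1 s 0ℤ))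

coprime⇒¬both-even : ∀ x y → isCoprime x y + isEven x * isEven y ≤ 1
coprime⇒¬both-even x y with coprime? x y
... | no _ = *-mono-≤ (⟦⟧≤1 (+ 2 ∣ℤ? x)) (⟦⟧≤1 (+ 2 ∣ℤ? y))
... | yes coprime with + 2 ∣ℤ? x | + 2 ∣ℤ? y
...   | no _ | _ = ≤-refl
...   | yes _ | no _ = ≤-refl
...   | yes 2∣x | yes 2∣y = contradiction
  (ℕ∣.∣⇒≤ (subst (2 ℕ∣.∣_) coprime (gcd-greatest (ℤ∣.∣⇒∣ᵤ 2∣x) (ℤ∣.∣⇒∣ᵤ 2∣y)))) (λ { (s≤s ()) })

coprimePairs-upper : ∀ s → coprimePairs s + evens s * evens s ≤ size s * size s
coprimePairs-upper s = begin
  coprimePairs s + evens s * evens s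
    ≡⟨ cong (_+_ (coprimePairs s)) (pairSum-* s isEven isEven) ⟨
  coprimePairs s + pairSum s (λ x y → isEven x * isEven y)
    ≡⟨ pairSum-+ s isCoprime _ ⟨
  pairSum s (λ x y → isCoprime x y + isEven x * isEven y)
    ≤⟨ pairSum-mono s coprime⇒¬both-even ⟩
  pairSum s (λ _ _ → 1)
    ≡⟨ pairSum-1 s ⟩
  size s * size s ∎
  where open ≤-Reasoning

-- The threshold 2κ is such that an `oddNumber k` dividing a nonzero value that is not large has k <
-- κ.
isLarge : ℕ → ℤ → ℕ
isLarge κ y = ⟦ 2 * κ <? ℤ.∣ y ∣ ⟧

large : ℕ → ℕ → ℕ
large κ s = walkSum s (isLarge κ) 0ℤ

-- Chebyshev's inequality, from the second moment.
large-bound : ∀ κ s → 4 * (κ * κ) * large κ s ≤ s * size s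
large-bound κ s = begin
  4 * (κ * κ) * large κ s
    ≡⟨ walkSum-*ˡ s (4 * (κ * κ)) (isLarge κ) 0ℤ ⟨
  walkSum s (λ y → 4 * (κ * κ) * isLarge κ y) 0ℤ
    ≤⟨ walkSum-mono s chebyshev 0ℤ ⟩
  walkSum s absSq 0ℤ
    ≤⟨ walkSum-absSq s 0ℤ ⟩
  s * size s ∎
  where
  open ≤-Reasoning
  square : ∀ κ → 4 * (κ * κ) * 1 ≡ 2 * κ * (2 * κ)
  square = solve-∀
  chebyshev : ∀ y → 4 * (κ * κ) * isLarge κ y ≤ absSq y
  chebyshev y with 2 * κ <? ℤ.∣ y ∣
  ... | yes 2κ<∣y∣ = ≤-trans (≤-reflexive (square κ)) (*-mono-≤ (<⇒≤ 2κ<∣y∣) (<⇒≤ 2κ<∣y∣))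
  ... | no _ = ≤-trans (≤-reflexive (*-zeroʳ (4 * (κ * κ)))) z≤n

parity : ∀ n → ∃[ h ] (n ≡ 2 * h ⊎ n ≡ 1 + 2 * h)
parity zero = 0 , inj₁ refl
parity (suc n) with parity n
... | h , inj₁ refl = h , inj₂ refl
... | h , inj₂ refl = suc h , inj₁ (double h)
  where
  double : ∀ h → 2 + 2 * h ≡ 2 * (1 + h)
  double = solve-∀

-- The list starts at 3, since a common divisor 1 is no obstacle; the form fits `multiples-bound`
-- with m = 1 + k.
oddNumber : ℕ → ℕ
oddNumber k = 1 + 2 * (1 + k)

oddDivisors : ℕ → ℤ → ℤ → ℕ
oddDivisors κ x y = sumBelow κ (λ k → isMultiple (oddNumber k) x * isMultiple (oddNumber k) y)

-- A union bound: if the gcd is not 1, it is even or is itself one of the odd divisors. Its size is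
-- controlled by x alone, so only x is tested for being 0 or large.
isCoprime-lower : ∀ κ x y → 1 ≤ isCoprime x y
  + (isEven x * isEven y + (isZero x + (isLarge κ x + oddDivisors κ x y)))
isCoprime-lower κ x y with coprime? x y
... | yes _ = m≤m+n 1 _
... | no ¬coprime with x ℤ.≟ 0ℤ
...   | yes _ = m≤n⇒m≤o+n (isEven x * isEven y) (m≤m+n 1 _)
...   | no x≢0 with 2 * κ <? ℤ.∣ x ∣
...     | yes _ = m≤n⇒m≤o+n (isEven x * isEven y) (m≤m+n 1 _)
...     | no small with parity (gcd ℤ.∣ x ∣ ℤ.∣ y ∣)
...       | h , inj₁ g≡2h = ≤-trans (≤-reflexive (sym (cong₂ _*_
              (isMultiple-yes x (ℕ∣.∣-trans 2∣g (gcd[m,n]∣m _ _)))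
              (isMultiple-yes y (ℕ∣.∣-trans 2∣g (gcd[m,n]∣n ℤ.∣ x ∣ _))))))
            (m≤m+n _ _)
  where
  2∣g : 2 ℕ∣.∣ gcd ℤ.∣ x ∣ ℤ.∣ y ∣
  2∣g = subst (2 ℕ∣.∣_) (sym g≡2h) (ℕ∣.m∣m*n h)
...       | zero , inj₂ g≡1 = contradiction g≡1 ¬coprime
...       | suc k , inj₂ g≡odd = m≤n⇒m≤o+n (isEven x * isEven y) (begin
            1                                                   ≡⟨ cong₂ _*_
              (isMultiple-yes x (subst (λ g → g ℕ∣.∣ ℤ.∣ x ∣) g≡odd (gcd[m,n]∣m ℤ.∣ x ∣ ℤ.∣ y ∣)))
              (isMultiple-yes y (subst (λ g → g ℕ∣.∣ ℤ.∣ y ∣) g≡odd (gcd[m,n]∣n ℤ.∣ x ∣ ℤ.∣ y ∣))) ⟨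
            isMultiple (oddNumber k) x * isMultiple (oddNumber k) y
              ≤⟨ term≤sumBelow (λ k → isMultiple (oddNumber k) x * isMultiple (oddNumber k) y) k<κ ⟩
            oddDivisors κ x y ∎)
  where
  open ≤-Reasoning
  g≤2κ : oddNumber k ≤ 2 * κ
  g≤2κ = ≤-trans (≤-reflexive (sym g≡odd)) (≤-trans
    (ℕ∣.∣⇒≤ {{ℕ.≢-nonZero (x≢0 ∘ ℤₚ.∣i∣≡0⇒i≡0)}} (gcd[m,n]∣m ℤ.∣ x ∣ ℤ.∣ y ∣)) (≮⇒≥ small))
  k<κ : k < κ
  k<κ = <⇒≤ (*-cancelˡ-< 2 (suc k) κ g≤2κ)

coprimePairs-lower : ∀ κ s → size s * size s ≤ coprimePairs s
  + (evens s * evens s + (returns s * size s + (large κ s * size s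
    + sumBelow κ (λ k → multiples (oddNumber k) s * multiples (oddNumber k) s))))
coprimePairs-lower κ s = begin
  size s * size s ≡⟨ pairSum-1 s ⟨
  pairSum s (λ _ _ → 1) ≤⟨ pairSum-mono s (isCoprime-lower κ) ⟩
  pairSum s (λ x y → isCoprime x y
    + (isEven x * isEven y + (isZero x + (isLarge κ x + oddDivisors κ x y))))
    ≡⟨ pairSum-+ s isCoprime _ ⟩
  coprimePairs s + pairSum s (λ x y →
    isEven x * isEven y + (isZero x + (isLarge κ x + oddDivisors κ x y)))
    ≡⟨ cong (_+_ (coprimePairs s)) (trans (pairSum-+ s (λ x y → isEven x * isEven y) _)
      (cong₂ _+_ (pairSum-* s isEven isEven) (trans (pairSum-+ s (λ x _ → isZero x) _)
        (cong₂ _+_ (pairSum-fst s isZero) (trans (pairSum-+ s (λ x _ → isLarge κ x) _)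
          (cong₂ _+_ (pairSum-fst s (isLarge κ))
            (trans (pairSum-sumBelow s κ _) oddTerms))))))) ⟩
  coprimePairs s + (evens s * evens s + (returns s * size s + (large κ s * size s
    + sumBelow κ (λ k → multiples (oddNumber k) s * multiples (oddNumber k) s)))) ∎
  where
  open ≤-Reasoning
  sumBelow-cong : ∀ n {f g : ℕ → ℕ} → (∀ k → f k ≡ g k) → sumBelow n f ≡ sumBelow n g
  sumBelow-cong zero e = refl
  sumBelow-cong (suc n) e = cong₂ _+_ (sumBelow-cong n e) (e n)
  oddTerms = sumBelow-cong κ (λ k → pairSum-* s (isMultiple (oddNumber k)) (isMultiple (oddNumber k)))

-- Each multiples d s is about size s / d + returns s.  The cross term of the square is
-- absorbed by AM-GM, at the price of the factor 13/12.
sum-multiples²-bound : ∀ κ s →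
  48 * sumBelow κ (λ k → multiples (oddNumber k) s * multiples (oddNumber k) s)
    ≤ 48 * (κ * (13 * (returns s * returns s))) + 13 * (size s * size s)
sum-multiples²-bound κ s = begin
  48 * sumBelow κ (λ k → c k * c k)
    ≤⟨ *-monoʳ-≤ 48 (sumBelow-mono κ (λ {k} _ → m≤n+m∸n (c k * c k) (13 * (H * H)))) ⟩
  48 * sumBelow κ (λ k → 13 * (H * H) + e k)
    ≡⟨ cong (_*_ 48) (trans (sumBelow-+ κ (λ _ → 13 * (H * H)) e)
         (cong (λ w → w + sumBelow κ e) (sumBelow-const κ (13 * (H * H))))) ⟩
  48 * (κ * (13 * (H * H)) + sumBelow κ e)
    ≡⟨ *-distribˡ-+ 48 (κ * (13 * (H * H))) (sumBelow κ e) ⟩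
  48 * (κ * (13 * (H * H))) + 48 * sumBelow κ e
    ≡⟨ cong (_+_ (48 * (κ * (13 * (H * H))))) (sumBelow-*ˡ 48 κ e) ⟨
  48 * (κ * (13 * (H * H))) + sumBelow κ (λ k → 48 * e k)
    ≤⟨ +-monoʳ-≤ (48 * (κ * (13 * (H * H)))) (telescope (13 * (N * N)) (λ k → 48 * e k) term-bound κ) ⟩
  48 * (κ * (13 * (H * H))) + 13 * (N * N) ∎
  where
  open ≤-Reasoning
  N = size s
  H = returns s
  c e : ℕ → ℕ
  c k = multiples (oddNumber k) s
  -- Truncated subtraction leaves the excess over the error 13H²; only this part has to telescope.
  e k = c k * c k ∸ 13 * (H * H)
  square : ∀ d c → 12 * (d * d) * (c * c) ≡ 12 * (d * c * (d * c))
  square = solve-∀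
  expand : ∀ d H N → 12 * ((d * H + N) * (d * H + N))
    ≡ 12 * (d * d * (H * H)) + 12 * (N * N) + 2 * (12 * (d * H) * N)
  expand = solve-∀
  collect : ∀ d H N → 12 * (d * d * (H * H)) + 12 * (N * N) + (12 * (d * H) * (12 * (d * H)) + N * N)
    ≡ 12 * (d * d) * (13 * (H * H)) + 13 * (N * N)
  collect = solve-∀
  squared : ∀ k → let d = oddNumber k in
    12 * (d * d) * (c k * c k) ≤ 12 * (d * d) * (13 * (H * H)) + 13 * (N * N)
  squared k = begin
    12 * (d * d) * (c k * c k)       ≡⟨ square d (c k) ⟩
    12 * (d * c k * (d * c k))       ≤⟨ *-monoʳ-≤ 12 (*-mono-≤ bound bound) ⟩
    12 * ((d * H + N) * (d * H + N)) ≡⟨ expand d H N ⟩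
    12 * (d * d * (H * H)) + 12 * (N * N) + 2 * (12 * (d * H) * N)
      -- Putting the weight 12 on dH costs a single N², while the coefficient of d²H² becomes 12 +
      -- 144 = 12 · 13.
      ≤⟨ +-monoʳ-≤ (12 * (d * d * (H * H)) + 12 * (N * N)) (2mn≤m²+n² (12 * (d * H)) N) ⟩
    12 * (d * d * (H * H)) + 12 * (N * N) + (12 * (d * H) * (12 * (d * H)) + N * N)
      ≡⟨ collect d H N ⟩
    12 * (d * d) * (13 * (H * H)) + 13 * (N * N) ∎
    where
    d = oddNumber k
    bound = multiples-bound s (1 + k)
  -- For d = 2k + 3 this is d² - 1 = 4(k+1)(k+2), which brings the sum into telescoping form.
  factor : ∀ k x → 48 * x * ((1 + k) * (2 + k)) + 12 * x
    ≡ 12 * ((1 + 2 * (1 + k)) * (1 + 2 * (1 + k))) * x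
  factor = solve-∀
  term-bound : ∀ k → 48 * e k * ((1 + k) * (2 + k)) ≤ 13 * (N * N)
  term-bound k = begin
    48 * e k * ((1 + k) * (2 + k))            ≤⟨ m≤m+n _ (12 * e k) ⟩
    48 * e k * ((1 + k) * (2 + k)) + 12 * e k ≡⟨ factor k (e k) ⟩
    12 * (d * d) * e k                        ≡⟨ *-distribˡ-∸ (12 * (d * d)) (c k * c k) (13 * (H * H)) ⟩
    12 * (d * d) * (c k * c k) ∸ 12 * (d * d) * (13 * (H * H))
      ≤⟨ m≤n+o⇒m∸n≤o (12 * (d * d) * (c k * c k)) (12 * (d * d) * (13 * (H * H))) (squared k) ⟩
    13 * (N * N) ∎
    where d = oddNumber k

s≤size : ∀ s → s ≤ size s
s≤size zero = z≤n
s≤size (suc s) = s≤s (≤-trans (s≤size s) (m≤m+n _ _))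

-- In units of N²/720 the losses are 80 (both values even), 195 (common odd divisor), 8 (large
-- value), 5 (value 0), and 5 for the error term Q, whose bound needs r ≥ 144 * 1170 = 168480.
coprimePairs-odd : ∀ r m → 168480 ≤ r → suc m ≡ 2 * (r * r) → let N = size (1 + m * 2) in
  427 * (N * N) ≤ 720 * coprimePairs (1 + m * 2)
coprimePairs-odd r m r-large 1+m≡2r² = +-cancelʳ-≤ (293 * X) (427 * X) (720 * C) (begin
  427 * X + 293 * X
    ≡⟨ *-distribʳ-+ X 427 293 ⟨
  720 * X
    ≤⟨ *-monoʳ-≤ 720 (coprimePairs-lower κ s) ⟩
  720 * (C + (E * E + (H * N + (L * N + M))))
    ≡⟨ distribute C (E * E) (H * N) (L * N) M ⟩
  720 * C + (80 * (9 * (E * E)) + (5 * (144 * (H * N)) + (8 * (90 * (L * N)) + 15 * (48 * M))))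
    ≤⟨ +-monoʳ-≤ (720 * C) (+-mono-≤ (*-monoʳ-≤ 80 E-bound) (+-mono-≤ (*-monoʳ-≤ 5 H-bound)
        (+-mono-≤ (*-monoʳ-≤ 8 L-bound) (*-monoʳ-≤ 15 (sum-multiples²-bound κ s))))) ⟩
  720 * C + (80 * X + (5 * X + (8 * X + 15 * (48 * Q + 13 * X))))
    ≡⟨ regroup C Q X ⟩
  720 * C + (5 * (144 * Q) + 288 * X)
    ≤⟨ +-monoʳ-≤ (720 * C) (+-monoˡ-≤ (288 * X) (*-monoʳ-≤ 5 Q-bound)) ⟩
  720 * C + (5 * X + 288 * X)
    ≡⟨ cong (_+_ (720 * C)) (*-distribʳ-+ X 5 288) ⟨
  720 * C + 293 * X ∎)
  where
  open ≤-Reasoning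
  s = 1 + m * 2
  -- With this choice 2κ is ten times √(s + 1), so at most 1/100 of the values are large; 8/720 =
  -- 1/90 is allowed for them.
  κ = 10 * r
  N = size s
  X = N * N
  C = coprimePairs s
  E = evens s
  H = returns s
  L = large κ s
  M = sumBelow κ (λ k → multiples (oddNumber k) s * multiples (oddNumber k) s)
  Q = κ * (13 * (H * H))
  -- 720 is split as 80 · 9, 5 · 144, 8 · 90 and 15 · 48 to match the factors in the four bounds.
  distribute : ∀ c e h l m → 720 * (c + (e + (h + (l + m))))
    ≡ 720 * c + (80 * (9 * e) + (5 * (144 * h) + (8 * (90 * l) + 15 * (48 * m))))
  distribute = solve-∀
  regroup : ∀ c q x → 720 * c + (80 * x + (5 * x + (8 * x + 15 * (48 * q + 13 * x))))
    ≡ 720 * c + (5 * (144 * q) + 288 * x)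
  regroup = solve-∀
  instance
    r≢0 : ℕ.NonZero r
    r≢0 = ℕ.>-nonZero (≤-trans (m≤m+n 1 168479) r-large)
  rH≤3N : r * H ≤ 3 * N
  rH≤3N = returns-bound r m 1+m≡2r²
  E-bound : 9 * (E * E) ≤ X
  E-bound = ≤-reflexive (trans (square E) (sym (cong₂ _*_ (size≡3evens m) (size≡3evens m))))
    where
    square : ∀ e → 9 * (e * e) ≡ 3 * e * (3 * e)
    square = solve-∀
  H-bound : 144 * (H * N) ≤ X
  H-bound = ≤-trans (≤-reflexive (sym (*-assoc 144 H N))) (*-monoˡ-≤ N (*-cancelˡ-≤ 3 (begin
    3 * (144 * H) ≡⟨ *-assoc 3 144 H ⟨
    432 * H       ≤⟨ *-monoˡ-≤ H (≤-trans (m≤m+n 432 168048) r-large) ⟩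
    r * H         ≤⟨ rH≤3N ⟩
    3 * N         ∎)))
  L-bound : 90 * (L * N) ≤ X
  L-bound = ≤-trans (≤-reflexive (sym (*-assoc 90 L N))) (*-monoˡ-≤ N (≤-trans
    (*-monoˡ-≤ L (m≤m+n 90 10)) (*-cancelˡ-≤ (4 * (r * r)) {{m*n≢0 4 (r * r) {{_}} {{m*n≢0 r r}}}} (begin
      4 * (r * r) * (100 * L)  ≡⟨ square r L ⟩
      4 * (κ * κ) * L          ≤⟨ large-bound κ s ⟩
      s * N                    ≤⟨ *-monoˡ-≤ N (n≤1+n s) ⟩
      suc m * 2 * N            ≡⟨ cong (λ w → w * 2 * N) 1+m≡2r² ⟩
      2 * (r * r) * 2 * N      ≡⟨ collect r N ⟩
      4 * (r * r) * N          ∎))))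
    where
    square : ∀ r l → 4 * (r * r) * (100 * l) ≡ 4 * (10 * r * (10 * r)) * l
    square = solve-∀
    collect : ∀ r n → 2 * (r * r) * 2 * n ≡ 4 * (r * r) * n
    collect = solve-∀
  -- Q is 130 r H² and H is at most 3N/r, so Q is at most 1170 N²/r.
  Q-bound : 144 * Q ≤ X
  Q-bound = *-cancelˡ-≤ 1170 (begin
    1170 * (144 * Q)         ≡⟨ *-assoc 1170 144 Q ⟨
    168480 * Q               ≤⟨ *-monoˡ-≤ Q r-large ⟩
    r * Q                    ≡⟨ square r H ⟩
    130 * (r * H * (r * H))  ≤⟨ *-monoʳ-≤ 130 (*-mono-≤ rH≤3N rH≤3N) ⟩
    130 * (3 * N * (3 * N))  ≡⟨ collect N ⟩
    1170 * X                 ∎)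
    where
    square : ∀ r h → r * (10 * r * (13 * (h * h))) ≡ 130 * (r * h * (r * h))
    square = solve-∀
    collect : ∀ n → 130 * (3 * n * (3 * n)) ≡ 1170 * (n * n)
    collect = solve-∀

-- Twice the number of unordered pairs of distinct words, and of those among them that are
-- coprime, is the number of ordered pairs minus the contribution D of the diagonal.
module _ (s P Pφ D : ℕ) (pairs : 2 * P + size s ≡ size s * size s)
         (coprime : 2 * Pφ + D ≡ coprimePairs s) where

  open ≤-Reasoning

  -- With O odd values there are 2O + 1 even ones, so the ratio is at most (5O² + 2O)/(9O² + 3O).
  -- This is at most 4/7 once O ≥ 2, which holds from s = 2 on.
  even-ratio : ∀ n → s ≡ (1 + n) * 2 → 7 * Pφ ≤ 4 * P
  even-ratio n refl = *-cancelˡ-≤ 2 (begin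
    2 * (7 * Pφ)                 ≡⟨ swap 7 Pφ ⟩
    7 * (2 * Pφ)                 ≤⟨ *-monoʳ-≤ 7 (≤-trans (m≤m+n _ D) (≤-reflexive coprime)) ⟩
    7 * coprimePairs s           ≤⟨ *-monoʳ-≤ 7 C-bound ⟩
    7 * (5 * (O * O) + 2 * O)    ≡⟨ expand O ⟩
    35 * (O * O) + 12 * O + 2 * O ≤⟨ +-monoʳ-≤ (35 * (O * O) + 12 * O) (*-monoˡ-≤ O 2≤O) ⟩
    35 * (O * O) + 12 * O + O * O ≡⟨ collect O ⟩
    4 * (9 * (O * O) + 3 * O)    ≡⟨ cong (_*_ 4) P-value ⟨
    4 * (2 * P)                  ≡⟨ swap 4 P ⟨
    2 * (4 * P)                  ∎)
    where
    O = odds s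
    swap : ∀ c x → 2 * (c * x) ≡ c * (2 * x)
    swap = solve-∀
    expand : ∀ o → 7 * (5 * (o * o) + 2 * o) ≡ 35 * (o * o) + 12 * o + 2 * o
    expand = solve-∀
    collect : ∀ o → 35 * (o * o) + 12 * o + o * o ≡ 4 * (9 * (o * o) + 3 * o)
    collect = solve-∀
    evens-value : evens s ≡ 1 + 2 * O
    evens-value = evens≡1+2odds (1 + n)
    size-value : size s ≡ 1 + 2 * O + O
    size-value = trans (size≡evens+odds s) (cong (λ e → e + O) evens-value)
    2≤O : 2 ≤ O
    2≤O = ≤-trans (*-monoʳ-≤ 2 (≤-trans (s≤s z≤n) (≤-reflexive (sym (evens-suc (n * 2))))))
      (≤-reflexive (sym (odds-suc (1 + n * 2))))
    square : ∀ o → (1 + 2 * o + o) * (1 + 2 * o + o)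
      ≡ 5 * (o * o) + 2 * o + (1 + 2 * o) * (1 + 2 * o)
    square = solve-∀
    square′ : ∀ o → (1 + 2 * o + o) * (1 + 2 * o + o)
      ≡ 9 * (o * o) + 3 * o + (1 + 2 * o + o)
    square′ = solve-∀
    C-bound : coprimePairs s ≤ 5 * (O * O) + 2 * O
    C-bound = +-cancelʳ-≤ ((1 + 2 * O) * (1 + 2 * O)) _ _ (begin
      coprimePairs s + (1 + 2 * O) * (1 + 2 * O)
        ≡⟨ cong (λ e → coprimePairs s + e * e) evens-value ⟨
      coprimePairs s + evens s * evens s ≤⟨ coprimePairs-upper s ⟩
      size s * size s                    ≡⟨ cong₂ _*_ size-value size-value ⟩
      (1 + 2 * O + O) * (1 + 2 * O + O)  ≡⟨ square O ⟩
      5 * (O * O) + 2 * O + (1 + 2 * O) * (1 + 2 * O) ∎)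
    P-value : 2 * P ≡ 9 * (O * O) + 3 * O
    P-value = +-cancelʳ-≡ (1 + 2 * O + O) _ _ (begin-equality
      2 * P + (1 + 2 * O + O)           ≡⟨ cong (_+_ (2 * P)) size-value ⟨
      2 * P + size s                    ≡⟨ pairs ⟩
      size s * size s                   ≡⟨ cong₂ _*_ size-value size-value ⟩
      (1 + 2 * O + O) * (1 + 2 * O + O) ≡⟨ square′ O ⟩
      9 * (O * O) + 3 * O + (1 + 2 * O + O) ∎)

  -- 427/720 exceeds 7/12 = 420/720 by 7/720. This margin pays for the diagonal, whose contribution
  -- is at most N out of N² pairs.
  odd-ratio : ∀ r m → 168480 ≤ r → suc m ≡ 2 * (r * r) → s ≡ 1 + m * 2 → D ≤ size s →
    7 * P ≤ 12 * Pφ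
  odd-ratio r m r-large 1+m≡2r² refl D≤N = *-cancelˡ-≤ 120 (+-cancelʳ-≤ (7 * X) _ _ (begin
    120 * (7 * P) + 7 * X       ≡⟨ cong (λ w → w + 7 * X) (regroup P) ⟩
    420 * (2 * P) + 7 * X       ≤⟨ +-monoˡ-≤ (7 * X) (*-monoʳ-≤ 420 (≤-trans (m≤m+n _ N) (≤-reflexive pairs))) ⟩
    420 * X + 7 * X             ≡⟨ *-distribʳ-+ X 420 7 ⟨
    427 * X                     ≤⟨ coprimePairs-odd r m r-large 1+m≡2r² ⟩
    720 * coprimePairs s        ≡⟨ cong (_*_ 720) coprime ⟨
    720 * (2 * Pφ + D)          ≤⟨ *-monoʳ-≤ 720 (+-monoʳ-≤ (2 * Pφ) D≤N) ⟩
    720 * (2 * Pφ + N)          ≡⟨ regroup′ Pφ N ⟩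
    120 * (12 * Pφ) + 720 * N   ≤⟨ +-monoʳ-≤ (120 * (12 * Pφ)) (*-monoˡ-≤ N 720≤7N) ⟩
    120 * (12 * Pφ) + 7 * N * N ≡⟨ cong (_+_ (120 * (12 * Pφ))) (*-assoc 7 N N) ⟩
    120 * (12 * Pφ) + 7 * X     ∎))
    where
    N = size s
    X = N * N
    regroup : ∀ p → 120 * (7 * p) ≡ 420 * (2 * p)
    regroup = solve-∀
    regroup′ : ∀ p n → 720 * (2 * p + n) ≡ 120 * (12 * p) + 720 * n
    regroup′ = solve-∀
    instance
      r≢0 : ℕ.NonZero r
      r≢0 = ℕ.>-nonZero (≤-trans (m≤m+n 1 168479) r-large)
    r≤N : r ≤ N
    r≤N = begin
      r               ≤⟨ m≤m*n r r ⟩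
      r * r           ≤⟨ m≤m+n _ _ ⟩
      2 * (r * r)     ≡⟨ 1+m≡2r² ⟨
      suc m           ≤⟨ s≤s (m≤m*n m 2) ⟩
      s               ≤⟨ s≤size s ⟩
      N               ∎
    720≤7N : 720 ≤ 7 * N
    720≤7N = ≤-trans (≤-trans (m≤m+n 720 167760) (≤-trans r-large r≤N)) (m≤m+n N (6 * N))

-- One-cycles and coprimality

move : Symbol → ℤ → ℤ
move S = ℤ.suc
move S⁻¹ = ℤ.pred

position : Term → ℤ
position a = 0ℤ
position (apply f x) = move f (position x)

value : Word → ℤ
value [] = 0ℤ
value (f ∷ w) = move f (value w)

position-word : ∀ w → position (w · a) ≡ value w
position-word [] = refl
position-word (f ∷ w) = cong (move f) (position-word w)

IsCoprime : Presentation → Set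
IsCoprime p = gcd ℤ.∣ value (word₁ p) ∣ ℤ.∣ value (word₂ p) ∣ ≡ 1

move-difference : ∀ f x y → x ℤ.- y ≡ move f x ℤ.- move f y
move-difference S = shift 1ℤ
  where
  shift : ∀ c x y → x ℤ.- y ≡ (c ℤ.+ x) ℤ.- (c ℤ.+ y)
  shift = ℤ-Solver.solve-∀
move-difference S⁻¹ = shift ℤ.-1ℤ
  where
  shift : ∀ c x y → x ℤ.- y ≡ (c ℤ.+ x) ℤ.- (c ℤ.+ y)
  shift = ℤ-Solver.solve-∀

-- Soundness for the model of integers modulo d, where both identities hold.
⊢-position : ∀ {p d} → d ∣ℤ value (word₁ p) → d ∣ℤ value (word₂ p) →
  ∀ {x y} → p ⊢ x ≈ y → d ∣ℤ (position x ℤ.- position y)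
⊢-position {p} {d} d∣v₁ d∣v₂ = sound
  where
  swap : ∀ x y → ℤ.- (x ℤ.- y) ≡ y ℤ.- x
  swap = ℤ-Solver.solve-∀
  split : ∀ x y z → (x ℤ.- y) ℤ.+ (y ℤ.- z) ≡ x ℤ.- z
  split = ℤ-Solver.solve-∀
  equal : ∀ {x y} → x ≡ y → d ∣ℤ (x ℤ.- y)
  equal {x} refl = subst (d ∣ℤ_) (sym (ℤₚ.+-inverseʳ x)) (ℤ∣.divides 0ℤ refl)
  identity : ∀ w → d ∣ℤ value w → d ∣ℤ (position (w · a) ℤ.- 0ℤ)
  identity w = subst (d ∣ℤ_) (sym (trans (ℤₚ.+-identityʳ _) (position-word w)))
  sound : ∀ {x y} → p ⊢ x ≈ y → d ∣ℤ (position x ℤ.- position y)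
  sound (⊢-refl {x}) = equal {position x} refl
  sound (⊢-sym {x} {y} e) = subst (d ∣ℤ_) (swap (position x) (position y)) (ℤ∣.∣m⇒∣-m (sound e))
  sound (⊢-trans {x} {y} {z} e e′) =
    subst (d ∣ℤ_) (split (position x) (position y) (position z)) (ℤ∣.∣m∣n⇒∣m+n (sound e) (sound e′))
  sound (⊢-cong f {x} {y} e) = subst (d ∣ℤ_) (move-difference f (position x) (position y)) (sound e)
  sound (axiom-SS⁻¹ x) = equal (ℤₚ.suc-pred (position x))
  sound (axiom-S⁻¹S x) = equal (ℤₚ.pred-suc (position x))
  sound identity₁ = identity (word₁ p) d∣v₁
  sound identity₂ = identity (word₂ p) d∣v₂

-- A one-cycle satisfies S(a) = a, whose sides have positions 1 and 0, so the gcd of the two values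
-- divides 1.
oneCycle⇒coprime : ∀ p → IsOneCycle ⟨ p ⟩ → IsCoprime p
oneCycle⇒coprime p (x , all≈x) = ℕ∣.∣1⇒≡1 (ℤ∣.∣⇒∣ᵤ (⊢-position
  (ℤ∣.∣ᵤ⇒∣ {+ g} {v₁} (gcd[m,n]∣m ℤ.∣ v₁ ∣ ℤ.∣ v₂ ∣))
  (ℤ∣.∣ᵤ⇒∣ {+ g} {v₂} (gcd[m,n]∣n ℤ.∣ v₁ ∣ ℤ.∣ v₂ ∣))
  (⊢-trans (all≈x (apply S a)) (⊢-sym (all≈x a)))))
  where
  v₁ = value (word₁ p)
  v₂ = value (word₂ p)
  g = gcd ℤ.∣ v₁ ∣ ℤ.∣ v₂ ∣

-- The normal form S^z(a), to which `≈power` reduces every term.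
power : ℤ → Term
power (+ zero) = a
power (+ suc n) = apply S (power (+ n))
power -[1+ zero ] = apply S⁻¹ a
power -[1+ suc n ] = apply S⁻¹ (power -[1+ n ])

module _ (p : Presentation) where

  apply-power : ∀ f z → p ⊢ apply f (power z) ≈ power (move f z)
  apply-power S (+ n) = ⊢-refl
  apply-power S -[1+ zero ] = axiom-SS⁻¹ _
  apply-power S -[1+ suc n ] = axiom-SS⁻¹ _
  apply-power S⁻¹ (+ zero) = ⊢-refl
  apply-power S⁻¹ (+ suc n) = axiom-S⁻¹S _
  apply-power S⁻¹ -[1+ n ] = ⊢-refl

  ≈power : ∀ x → p ⊢ x ≈ power (position x)
  ≈power a = ⊢-refl
  ≈power (apply f x) = ⊢-trans (⊢-cong f (≈power x)) (apply-power f (position x))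

  move-≈ : ∀ f {x y} → p ⊢ power x ≈ power y → p ⊢ power (move f x) ≈ power (move f y)
  move-≈ f {x} {y} e =
    ⊢-trans (⊢-sym (apply-power f x)) (⊢-trans (⊢-cong f e) (apply-power f y))

  translate : ∀ k {x y} → p ⊢ power x ≈ power y → p ⊢ power (k ℤ.+ x) ≈ power (k ℤ.+ y)
  translate (+ zero) {x} {y} e
    rewrite ℤₚ.+-identityˡ x | ℤₚ.+-identityˡ y = e
  translate (+ suc n) {x} {y} e =
    subst₂ (λ x y → p ⊢ power x ≈ power y)
      (sym (ℤₚ.+-assoc 1ℤ (+ n) x)) (sym (ℤₚ.+-assoc 1ℤ (+ n) y)) (move-≈ S (translate (+ n) e))
  translate -[1+ zero ] e = move-≈ S⁻¹ e
  translate -[1+ suc n ] {x} {y} e =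
    subst₂ (λ x y → p ⊢ power x ≈ power y)
      (sym (ℤₚ.+-assoc ℤ.-1ℤ -[1+ n ] x)) (sym (ℤₚ.+-assoc ℤ.-1ℤ -[1+ n ] y))
      (move-≈ S⁻¹ (translate -[1+ n ] e))

  -- These z are the periods of the presented structure. The next lemmas give them the closure
  -- properties of a subgroup of ℤ, so that Bézout's identity applies.
  Trivial : ℤ → Set
  Trivial z = p ⊢ power z ≈ a

  trivial-+ : ∀ {m n} → Trivial m → Trivial n → Trivial (m ℤ.+ n)
  trivial-+ {m} {n} tm tn = ⊢-trans (translate m tn)
    (subst (λ z → p ⊢ power z ≈ a) (sym (ℤₚ.+-identityʳ m)) tm)

  trivial-neg : ∀ {m} → Trivial m → Trivial (ℤ.- m)
  trivial-neg {m} tm = ⊢-sym (subst₂ (λ x y → p ⊢ power x ≈ power y)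
    (ℤₚ.+-inverseˡ m) (ℤₚ.+-identityʳ (ℤ.- m)) (translate (ℤ.- m) tm))

  trivial-∣∣ : ∀ {m} → Trivial m → Trivial (+ ℤ.∣ m ∣)
  trivial-∣∣ {+ n} tm = tm
  trivial-∣∣ { -[1+ n ]} tm = trivial-neg { -[1+ n ]} tm

  trivial-* : ∀ k {n} → Trivial (+ n) → Trivial (+ (k * n))
  trivial-* zero tn = ⊢-refl
  trivial-* (suc k) {n} tn = trivial-+ {+ n} {+ (k * n)} tn (trivial-* k {n} tn)

  -- The hypothesis has the shape of Bézout's identity over ℕ, where the negative term stands on the
  -- other side.
  trivial-1 : ∀ {m n} → Trivial (+ m) → Trivial (+ n) → 1 + n ≡ m → Trivial 1ℤ
  trivial-1 {m} {n} tm tn refl = subst Trivial (cancel (+ n)) (trivial-+ {+ suc n} tm (trivial-neg {+ n} tn))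
    where
    cancel : ∀ n → (1ℤ ℤ.+ n) ℤ.- n ≡ 1ℤ
    cancel = ℤ-Solver.solve-∀

  trivial-all : Trivial 1ℤ → ∀ z → Trivial z
  trivial-all t₁ (+ n) = subst (λ n → Trivial (+ n)) (*-identityʳ n) (trivial-* n {1} t₁)
  trivial-all t₁ -[1+ n ] = trivial-neg {+ suc n} (trivial-all t₁ (+ suc n))

  trivial-word : ∀ w → p ⊢ w · a ≈ a → Trivial (+ ℤ.∣ value w ∣)
  trivial-word w e = trivial-∣∣ {value w} (subst Trivial (position-word w) (⊢-trans (⊢-sym (≈power (w · a))) e))

  -- Both values are periods up to sign, hence so is 1 by Bézout, and then every integer.
  coprime⇒oneCycle : IsCoprime p → IsOneCycle ⟨ p ⟩
  coprime⇒oneCycle coprime = a , λ x → ⊢-trans (≈power x) (trivial-all t₁ (position x))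
    where
    m = ℤ.∣ value (word₁ p) ∣
    n = ℤ.∣ value (word₂ p) ∣
    tm = trivial-word (word₁ p) identity₁
    tn = trivial-word (word₂ p) identity₂
    t₁ : Trivial 1ℤ
    t₁ with GCD.Bézout.identity (subst (GCD.GCD m n) coprime (GCD.gcd-GCD m n))
    ... | +- x y e = trivial-1 (trivial-* x {m} tm) (trivial-* y {n} tn) e
    ... | -+ x y e = trivial-1 (trivial-* y {n} tn) (trivial-* x {m} tm) e

-- Enumeration of presentations

lookup-injective : ∀ {A : Set} {R : A → A → Set} → (∀ {x y} → R x y → R y x) →
  ∀ {xs} → AllPairs (λ x y → ¬ R x y) xs → ∀ i j → R (lookup xs i) (lookup xs j) → i ≡ j
lookup-injective R-sym (_ ∷ _) zero zero _ = refl
lookup-injective R-sym (¬R ∷ _) zero (suc j) r = contradiction r (All.lookup ¬R (∈-lookup j))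
lookup-injective R-sym (¬R ∷ _) (suc i) zero r = contradiction (R-sym r) (All.lookup ¬R (∈-lookup i))
lookup-injective R-sym (_ ∷ unique) (suc i) (suc j) r = cong suc (lookup-injective R-sym unique i j r)

-- Equality in `A ∣ Q` ignores the proofs of `Q`, so it does not matter which proof accompanies an
-- entry.
enumeration⇒cardinality : (A : Setoid 0ℓ 0ℓ) {Q : Setoid.Carrier A → Set} →
  let open Setoid A in ∀ xs → AllPairs (λ x y → ¬ x ≈ y) xs → All Q xs →
  (∀ x → Q x → Any (x ≈_) xs) → HasCardinality (A ∣ Q) (length xs)
enumeration⇒cardinality A xs unique allQ complete = record
  { to = λ i → lookup xs i , All.lookup allQ (∈-lookup i)
  ; cong = λ { refl → A.refl }
  ; bijective = (λ {i} {j} → lookup-injective A.sym unique i j)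
              , λ (x , q) → Any.index (complete x q)
                          , λ { refl → A.sym (Anyₚ.lookup-index (complete x q)) }
  }
  where module A = Setoid A

-- The recursion runs over the proofs of inequality, because each presentation has to carry one.
pairsWith : ∀ w {ws : List Word} → All (w ≢_) ws → List Presentation
pairsWith w = All.reduce (presentation w _)

-- Each unordered pair is represented once, by the order in which its words occur in the list.
pairs : ∀ {ws} → Unique ws → List Presentation
pairs [] = []
pairs (w≢ws ∷ unique) = pairsWith _ w≢ws ++ pairs unique

pairsWith-All : ∀ {P : Word → Set} {w ws} (w≢ws : All (w ≢_) ws) → All P ws →
  All (λ q → word₁ q ≡ w × P (word₂ q)) (pairsWith w w≢ws)
pairsWith-All [] [] = []
pairsWith-All (_ ∷ w≢ws) (px ∷ pxs) = (refl , px) ∷ pairsWith-All w≢ws pxs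

pairs-All : ∀ {P : Word → Set} {ws} (unique : Unique ws) → All P ws →
  All (λ q → P (word₁ q) × P (word₂ q)) (pairs unique)
pairs-All [] [] = []
pairs-All (w≢ws ∷ unique) (px ∷ pxs) = Allₚ.++⁺
  (All.map (λ { (refl , py) → px , py }) (pairsWith-All w≢ws pxs)) (pairs-All unique pxs)

pairsWith-unique : ∀ {w ws} (w≢ws : All (w ≢_) ws) → Unique ws →
  AllPairs (λ p q → ¬ p ≋ q) (pairsWith w w≢ws)
pairsWith-unique [] [] = []
pairsWith-unique {w} (w≢x ∷ w≢xs) (x≢xs ∷ unique) =
  All.map (λ { (refl , x≢ , w≢) (inj₁ (_ , e)) → x≢ e ; (refl , x≢ , w≢) (inj₂ (e , _)) → w≢ e })
    (pairsWith-All w≢xs (All.zip (x≢xs , w≢xs)))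
  ∷ pairsWith-unique w≢xs unique

pairs-unique : ∀ {ws} (unique : Unique ws) → AllPairs (λ p q → ¬ p ≋ q) (pairs unique)
pairs-unique [] = []
pairs-unique (w≢ws ∷ unique) = AllPairsₚ.++⁺ (pairsWith-unique w≢ws unique) (pairs-unique unique)
  (All.map (λ { (refl , _) → All.map (λ { (w≢₁ , _) (inj₁ (e , _)) → w≢₁ e
                                       ; (_ , w≢₂) (inj₂ (e , _)) → w≢₂ e })
                               (pairs-All unique w≢ws) })
    (pairsWith-All w≢ws w≢ws))

∈-pairsWith : ∀ {w w′ ws} (w≢ws : All (w ≢_) ws) → w′ ∈ ws →
  Any (λ q → w ≡ word₁ q × w′ ≡ word₂ q) (pairsWith w w≢ws)
∈-pairsWith (_ ∷ _) (here refl) = here (refl , refl)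
∈-pairsWith (_ ∷ w≢ws) (there w′∈ws) = there (∈-pairsWith w≢ws w′∈ws)

pairs-complete : ∀ {ws} (unique : Unique ws) p → word₁ p ∈ ws → word₂ p ∈ ws →
  Any (p ≋_) (pairs unique)
pairs-complete (_ ∷ _) p (here refl) (here e) = contradiction (sym e) (distinct p)
pairs-complete (w≢ws ∷ _) p (here refl) (there ∈₂) =
  Anyₚ.++⁺ˡ (Any.map inj₁ (∈-pairsWith w≢ws ∈₂))
pairs-complete (w≢ws ∷ _) p (there ∈₁) (here refl) =
  Anyₚ.++⁺ˡ (Any.map (λ (e , f) → inj₂ (f , e)) (∈-pairsWith w≢ws ∈₁))
pairs-complete (w≢ws ∷ unique) p (there ∈₁) (there ∈₂) =
  Anyₚ.++⁺ʳ (pairsWith _ w≢ws) (pairs-complete unique p ∈₁ ∈₂)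

Σ[_]_ : ∀ {A : Set} → List A → (A → ℕ) → ℕ
Σ[ xs ] f = sum (map f xs)

Σ-cong : ∀ {A : Set} (xs : List A) {f g : A → ℕ} → (∀ x → f x ≡ g x) → Σ[ xs ] f ≡ Σ[ xs ] g
Σ-cong [] e = refl
Σ-cong (x ∷ xs) e = cong₂ _+_ (e x) (Σ-cong xs e)

Σ-+ : ∀ {A : Set} (xs : List A) (f g : A → ℕ) → Σ[ xs ] (λ x → f x + g x) ≡ Σ[ xs ] f + Σ[ xs ] g
Σ-+ [] f g = refl
Σ-+ (x ∷ xs) f g = trans (cong (_+_ (f x + g x)) (Σ-+ xs f g))
  (regroup (f x) (g x) (Σ[ xs ] f) (Σ[ xs ] g))
  where
  regroup : ∀ w x y z → w + x + (y + z) ≡ w + y + (x + z)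
  regroup = solve-∀

module _ {R : Presentation → Set} (R? : ∀ p → Dec (R p)) (f : Word → Word → ℕ)
         (f-comm : ∀ w w′ → f w w′ ≡ f w′ w)
         (count : ∀ p → ⟦ R? p ⟧ ≡ f (word₁ p) (word₂ p)) where

  length-filter-pairsWith : ∀ {w ws} (w≢ws : All (w ≢_) ws) →
    length (filter R? (pairsWith w w≢ws)) ≡ Σ[ ws ] f w
  length-filter-pairsWith [] = refl
  length-filter-pairsWith {w} {w′ ∷ ws} (w≢w′ ∷ w≢ws)
    with R? (presentation w w′ w≢w′) | count (presentation w w′ w≢w′)
  ... | yes _ | e = cong₂ _+_ e (length-filter-pairsWith w≢ws)
  ... | no _ | e = cong₂ _+_ e (length-filter-pairsWith w≢ws)

  -- In the square of all ordered pairs the parts above and below the diagonal have equal sums, as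
  -- `f` is symmetric. The induction splits off the first row and column.
  length-filter-pairs : ∀ {ws} (unique : Unique ws) →
    2 * length (filter R? (pairs unique)) + Σ[ ws ] (λ w → f w w) ≡ Σ[ ws ] (λ w → Σ[ ws ] f w)
  length-filter-pairs [] = refl
  length-filter-pairs {w ∷ ws} (w≢ws ∷ unique) = begin
    2 * length (filter R? (pairsWith w w≢ws ++ pairs unique)) + (f w w + D)
      ≡⟨ cong (λ l → 2 * l + (f w w + D)) (trans
           (cong length (filter-++ R? (pairsWith w w≢ws) (pairs unique)))
           (trans (length-++ (filter R? (pairsWith w w≢ws)))
             (cong (λ l → l + L) (length-filter-pairsWith w≢ws)))) ⟩
    2 * (Σ[ ws ] f w + L) + (f w w + D)
      ≡⟨ regroup (Σ[ ws ] f w) L (f w w) D ⟩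
    f w w + Σ[ ws ] f w + (Σ[ ws ] f w + (2 * L + D))
      ≡⟨ cong₂ (λ m n → f w w + Σ[ ws ] f w + (m + n))
           (Σ-cong ws (f-comm w)) (length-filter-pairs unique) ⟩
    f w w + Σ[ ws ] f w + (Σ[ ws ] (λ w′ → f w′ w) + Σ[ ws ] (λ w′ → Σ[ ws ] f w′))
      ≡⟨ cong (_+_ (f w w + Σ[ ws ] f w)) (Σ-+ ws (λ w′ → f w′ w) (λ w′ → Σ[ ws ] f w′)) ⟨
    f w w + Σ[ ws ] f w + Σ[ ws ] (λ w′ → f w′ w + Σ[ ws ] f w′) ∎
    where
    open ≡-Reasoning
    L = length (filter R? (pairs unique))
    D = Σ[ ws ] (λ w′ → f w′ w′)
    regroup : ∀ s l x d → 2 * (s + l) + (x + d) ≡ x + s + (s + (2 * l + d))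
    regroup = solve-∀

-- Words of bounded length as walks

words : ℕ → List Word
words zero = [] ∷ []
words (suc s) = [] ∷ map (S ∷_) (words s) ++ map (S⁻¹ ∷_) (words s)

words-unique : ∀ s → Unique (words s)
words-unique zero = [] ∷ []
words-unique (suc s) =
  Allₚ.++⁺ (Allₚ.map⁺ (All.universal (λ _ ()) (words s))) (Allₚ.map⁺ (All.universal (λ _ ()) (words s)))
  ∷ AllPairsₚ.++⁺
      (Uniqueₚ.map⁺ ∷-injectiveʳ (words-unique s))
      (Uniqueₚ.map⁺ ∷-injectiveʳ (words-unique s))
      (Allₚ.map⁺ (All.universal (λ _ → Allₚ.map⁺ (All.universal (λ _ ()) (words s))) (words s)))

words-length : ∀ s → All (λ w → length w ≤ s) (words s)
words-length zero = z≤n ∷ []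
words-length (suc s) = z≤n ∷ Allₚ.++⁺
  (Allₚ.map⁺ (All.map s≤s (words-length s))) (Allₚ.map⁺ (All.map s≤s (words-length s)))

∈-words : ∀ s w → length w ≤ s → w ∈ words s
∈-words zero [] _ = here refl
∈-words (suc s) [] _ = here refl
∈-words (suc s) (S ∷ w) (s≤s l) = there (∈-++⁺ˡ (∈-map⁺ (S ∷_) (∈-words s w l)))
∈-words (suc s) (S⁻¹ ∷ w) (s≤s l) =
  there (∈-++⁺ʳ (map (S ∷_) (words s)) (∈-map⁺ (S⁻¹ ∷_) (∈-words s w l)))

Σ-map : ∀ {A B : Set} (g : A → B) xs (f : B → ℕ) → Σ[ map g xs ] f ≡ Σ[ xs ] (f ∘ g)
Σ-map g [] f = refl
Σ-map g (x ∷ xs) f = cong (_+_ (f (g x))) (Σ-map g xs f)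

-- The leading symbol of a word acts last, but moves commute, so it can be taken as the first step
-- of the walk. The start x is arbitrary to absorb this step.
Σ-words-from : ∀ s (f : ℤ → ℕ) x → Σ[ words s ] (λ w → f (x ℤ.+ value w)) ≡ walkSum s f x
Σ-words-from zero f x = trans (+-identityʳ _) (cong f (ℤₚ.+-identityʳ x))
Σ-words-from (suc s) f x = cong₂ _+_ (cong f (ℤₚ.+-identityʳ x)) (begin
  Σ[ map (S ∷_) (words s) ++ map (S⁻¹ ∷_) (words s) ] h
    ≡⟨ cong sum (map-++ h (map (S ∷_) (words s)) _) ⟩
  sum (map h (map (S ∷_) (words s)) ++ map h (map (S⁻¹ ∷_) (words s)))
    ≡⟨ sum-++ (map h (map (S ∷_) (words s))) _ ⟩
  Σ[ map (S ∷_) (words s) ] h + Σ[ map (S⁻¹ ∷_) (words s) ] h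
    ≡⟨ cong₂ _+_ (Σ-map (S ∷_) (words s) h) (Σ-map (S⁻¹ ∷_) (words s) h) ⟩
  Σ[ words s ] (λ w → f (x ℤ.+ ℤ.suc (value w))) + Σ[ words s ] (λ w → f (x ℤ.+ ℤ.pred (value w)))
    ≡⟨ cong₂ _+_ (first S 1ℤ (λ _ → refl)) (first S⁻¹ ℤ.-1ℤ (λ _ → refl)) ⟩
  walkSum s f (ℤ.suc x) + walkSum s f (ℤ.pred x) ∎)
  where
  open ≡-Reasoning
  h : Word → ℕ
  h w = f (x ℤ.+ value w)
  swap : ∀ c x y → x ℤ.+ (c ℤ.+ y) ≡ (c ℤ.+ x) ℤ.+ y
  swap = ℤ-Solver.solve-∀
  first : ∀ b c → (∀ y → move b y ≡ c ℤ.+ y) →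
    Σ[ words s ] (λ w → f (x ℤ.+ move b (value w))) ≡ walkSum s f (c ℤ.+ x)
  first b c move≡ = trans
    (Σ-cong (words s) (λ w → cong f (trans (cong (λ y → x ℤ.+ y) (move≡ (value w))) (swap c x (value w)))))
    (Σ-words-from s f (c ℤ.+ x))

Σ-words : ∀ s (f : ℤ → ℕ) → Σ[ words s ] (f ∘ value) ≡ walkSum s f 0ℤ
Σ-words s f = trans (Σ-cong (words s) (λ w → cong f (sym (ℤₚ.+-identityˡ (value w)))))
  (Σ-words-from s f 0ℤ)

isCoprime-comm : ∀ x y → isCoprime x y ≡ isCoprime y x
isCoprime-comm x y = ⟦⟧-cong (coprime? x y) (coprime? y x)
  (trans (GCD.gcd-comm ℤ.∣ y ∣ ℤ.∣ x ∣)) (trans (GCD.gcd-comm ℤ.∣ x ∣ ℤ.∣ y ∣))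

isCoprime? : ∀ p → Dec (IsCoprime p)
isCoprime? p = coprime? (value (word₁ p)) (value (word₂ p))

IsCoprime-resp : ∀ {p q} → p ≋ q → IsCoprime p → IsCoprime q
IsCoprime-resp (inj₁ (refl , refl)) coprime = coprime
IsCoprime-resp {p} {q} (inj₂ (refl , refl)) coprime =
  trans (GCD.gcd-comm ℤ.∣ value (word₁ q) ∣ ℤ.∣ value (word₂ q) ∣) coprime

-- Counting presentations and one-cycles

presentations : ℕ → List Presentation
presentations s = pairs (words-unique s)

-- `R` is a decidable substitute for what `Q` demands beyond the length bound, so that the list can
-- be filtered; for one-cycles it is coprimality.
presentations-cardinality : ∀ s {Q R : Presentation → Set} (R? : ∀ p → Dec (R p)) →
  (∀ {p q} → p ≋ q → R p → R q) →
  (∀ p → HasLengthAtMost s p → R p → Q p) →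
  (∀ p → Q p → HasLengthAtMost s p × R p) →
  HasCardinality (presentationSetoid ∣ Q) (length (filter R? (presentations s)))
presentations-cardinality s R? R-resp to from = enumeration⇒cardinality presentationSetoid
  (filter R? (presentations s))
  (AllPairsₚ.filter⁺ R? (pairs-unique (words-unique s)))
  (All.zipWith (λ { {p} (l , r) → to p l r })
    (Allₚ.filter⁺ R? (pairs-All (words-unique s) (words-length s)) , Allₚ.all-filter R? (presentations s)))
  (λ p q → let ((l₁ , l₂) , r) = from p q in
    Setoid∈.∈-filter⁺ presentationSetoid R? R-resp
      (pairs-complete (words-unique s) p (∈-words s _ l₁) (∈-words s _ l₂)) r)

-- Filtering by a predicate that always holds lets both counts go through the same lemmas.
#presentations #oneCycles : ℕ → ℕ
#presentations s = length (filter (λ _ → yes tt) (presentations s))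
#oneCycles s = length (filter isCoprime? (presentations s))

#presentations-isP : ∀ s → IsP s (#presentations s)
#presentations-isP s = presentations-cardinality s (λ _ → yes tt) (λ _ _ → tt)
  (λ _ l _ → l) (λ _ l → l , tt)

#oneCycles-isP : ∀ s → IsP[ IsOneCycle ] s (#oneCycles s)
#oneCycles-isP s = presentations-cardinality s isCoprime? (λ {p} {q} → IsCoprime-resp {p} {q})
  (λ p l coprime → l , coprime⇒oneCycle p coprime)
  (λ p (l , oneCycle) → l , oneCycle⇒coprime p oneCycle)

Σ-words-const : ∀ s c → Σ[ words s ] (λ _ → c) ≡ c * size s
Σ-words-const s c = trans (Σ-words s (λ _ → c)) (walkSum-const s c 0ℤ)

2*#presentations : ∀ s → 2 * #presentations s + size s ≡ size s * size s
2*#presentations s = begin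
  2 * #presentations s + size s
    ≡⟨ cong (_+_ (2 * #presentations s)) #words ⟨
  2 * #presentations s + Σ[ words s ] (λ _ → 1)
    ≡⟨ length-filter-pairs (λ _ → yes tt) (λ _ _ → 1) (λ _ _ → refl) (λ _ → refl) (words-unique s) ⟩
  Σ[ words s ] (λ _ → Σ[ words s ] (λ _ → 1))
    ≡⟨ trans (Σ-words-const s _) (cong (λ n → n * size s) #words) ⟩
  size s * size s ∎
  where
  open ≡-Reasoning
  #words : Σ[ words s ] (λ _ → 1) ≡ size s
  #words = trans (Σ-words-const s 1) (*-identityˡ _)

-- As gcd(x, x) = |x|, this counts the words of value 1 or -1.
diagonal : ℕ → ℕ
diagonal s = walkSum s (λ x → isCoprime x x) 0ℤ

diagonal≤size : ∀ s → diagonal s ≤ size s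
diagonal≤size s = ≤-trans (walkSum-mono s (λ x → ⟦⟧≤1 (coprime? x x)) 0ℤ) (≤-reflexive (walkSum-1 s 0ℤ))

2*#oneCycles : ∀ s → 2 * #oneCycles s + diagonal s ≡ coprimePairs s
2*#oneCycles s = begin
  2 * #oneCycles s + diagonal s
    ≡⟨ cong (_+_ (2 * #oneCycles s)) (Σ-words s (λ x → isCoprime x x)) ⟨
  2 * #oneCycles s + Σ[ words s ] (λ w → isCoprime (value w) (value w))
    ≡⟨ length-filter-pairs isCoprime? (λ w w′ → isCoprime (value w) (value w′))
         (λ w w′ → isCoprime-comm (value w) (value w′)) (λ _ → refl) (words-unique s) ⟩
  Σ[ words s ] (λ w → Σ[ words s ] (λ w′ → isCoprime (value w) (value w′)))
    ≡⟨ Σ-cong (words s) (λ w → Σ-words s (isCoprime (value w))) ⟩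
  Σ[ words s ] (λ w → walkSum s (isCoprime (value w)) 0ℤ)
    ≡⟨ Σ-words s (λ x → walkSum s (isCoprime x) 0ℤ) ⟩
  coprimePairs s ∎
  where open ≡-Reasoning

-- Limits

-- Since `_/_` reduces fractions to lowest terms, the comparison is made by cross multiplication of
-- unnormalised rationals.
ratio-≤ : ∀ m n c d → suc d * m ≤ c * n → ratio m n ℚ.≤ + c ℚ./ suc d
-- For denominator 0 the dummy value 0 lies below the nonnegative bound.
ratio-≤ m zero c d le = ℚₚ.toℚᵘ-cancel-≤ (ℚᵘₚ.≤-respʳ-≃
  (ℚᵘₚ.≃-sym (ℚₚ.toℚᵘ-fromℚᵘ (ℚᵘ.mkℚᵘ (+ c) d)))
  (ℚᵘ.*≤* (ℤₚ.≤-trans (ℤ.+≤+ z≤n) (ℤₚ.≤-reflexive (ℤₚ.pos-* c 1)))))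
ratio-≤ m (suc n) c d le = ℚₚ.toℚᵘ-cancel-≤ (ℚᵘₚ.≤-respˡ-≃
  (ℚᵘₚ.≃-sym (ℚₚ.toℚᵘ-fromℚᵘ (ℚᵘ.mkℚᵘ (+ m) n))) (ℚᵘₚ.≤-respʳ-≃
  (ℚᵘₚ.≃-sym (ℚₚ.toℚᵘ-fromℚᵘ (ℚᵘ.mkℚᵘ (+ c) d)))
  (ℚᵘ.*≤* (subst₂ ℤ._≤_ (ℤₚ.pos-* m (suc d)) (ℤₚ.pos-* c (suc n))
    (ℤ.+≤+ (≤-trans (≤-reflexive (*-comm m (suc d))) le))))))

≤-ratio : ∀ m n c d → 1 ≤ n → c * n ≤ suc d * m → + c ℚ./ suc d ℚ.≤ ratio m n
≤-ratio m (suc n) c d _ le = ℚₚ.toℚᵘ-cancel-≤ (ℚᵘₚ.≤-respʳ-≃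
  (ℚᵘₚ.≃-sym (ℚₚ.toℚᵘ-fromℚᵘ (ℚᵘ.mkℚᵘ (+ m) n))) (ℚᵘₚ.≤-respˡ-≃
  (ℚᵘₚ.≃-sym (ℚₚ.toℚᵘ-fromℚᵘ (ℚᵘ.mkℚᵘ (+ c) d)))
  (ℚᵘ.*≤* (subst₂ ℤ._≤_ (ℤₚ.pos-* c (suc n)) (ℤₚ.pos-* m (suc d))
    (ℤ.+≤+ (≤-trans le (≤-reflexive (*-comm (suc d) m))))))))

-- If r ≤ q, then r would lie in the lower cut as well, by roundedness, against disjointness.
lower<upper : ∀ (x : ℝ) {q r} → ℝ.Lower x q → ℝ.Upper x r → q ℚ.< r
lower<upper x {q} {r} q<x x<r with ℚₚ.<-cmp q r
... | tri< q<r _ _ = q<r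
... | tri≈ _ refl _ = contradiction (q<x , x<r) (ℝ.disjoint x q)
... | tri> _ _ r<q = contradiction
  (Equivalence.from (ℝ.lower-rounded x r) (q , r<q , q<x) , x<r) (ℝ.disjoint x r)

-- Taking r as a multiple of both the threshold and `suc N` makes the odd length 4r² - 1 meet both
-- bounds.
large-enough : ∀ N → ∃[ r ] ∃[ m ] (168480 ≤ r × suc m ≡ 2 * (r * r) × N ≤ 1 + m * 2)
large-enough N = r , ℕ.pred (2 * (r * r)) , m≤m*n 168480 (suc N) , 1+m≡2r² , (begin
  N             ≤⟨ n≤1+n N ⟩
  suc N         ≤⟨ m≤n*m (suc N) 168480 ⟩
  r             ≤⟨ m≤m*n r r ⟩
  r * r         ≤⟨ m≤m+n _ _ ⟩
  2 * (r * r)   ≡⟨ 1+m≡2r² ⟨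
  suc m         ≤⟨ s≤s (m≤m*n m 2) ⟩
  1 + m * 2     ∎)
  where
  open ≤-Reasoning
  r = 168480 * suc N
  m = ℕ.pred (2 * (r * r))
  1+m≡2r² : suc m ≡ 2 * (r * r)
  1+m≡2r² = suc-pred (2 * (r * r)) {{m*n≢0 2 (r * r) {{_}} {{m*n≢0 r r}}}}

oneCycleRatio : ℕ → ℚ
oneCycleRatio s = ratio (#oneCycles s) (#presentations s)

oneCycleRatio-even : ∀ n → oneCycleRatio ((1 + n) * 2) ℚ.≤ + 4 ℚ./ 7
oneCycleRatio-even n = ratio-≤ (#oneCycles s) (#presentations s) 4 6
  (even-ratio s (#presentations s) (#oneCycles s) (diagonal s)
    (2*#presentations s) (2*#oneCycles s) n refl)
  where s = (1 + n) * 2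

-- Without presentations N = N² would hold for the number N ≥ 2 of words. This excludes the dummy
-- value of `ratio`.
#presentations-positive : ∀ s → 1 ≤ #presentations (suc s)
#presentations-positive s =
  positive (#presentations (suc s)) (size (suc s)) (s≤s (≤-trans (1≤size s) (m≤m+n _ _)))
    (2*#presentations (suc s))
  where
  positive : ∀ P N → 2 ≤ N → 2 * P + N ≡ N * N → 1 ≤ P
  positive zero N@(suc _) 2≤N N≡N² = contradiction
    (*-cancelʳ-≤ N 1 N (≤-reflexive (trans (sym N≡N²) (sym (*-identityˡ N))))) (<⇒≱ 2≤N)
  positive (suc P) N _ _ = s≤s z≤n

oneCycleRatio-odd : ∀ r m → 168480 ≤ r → suc m ≡ 2 * (r * r) →
  + 7 ℚ./ 12 ℚ.≤ oneCycleRatio (1 + m * 2)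
oneCycleRatio-odd r m r-large 1+m≡2r² =
  ≤-ratio (#oneCycles s) (#presentations s) 7 11 (#presentations-positive (m * 2))
    (odd-ratio s (#presentations s) (#oneCycles s) (diagonal s)
      (2*#presentations s) (2*#oneCycles s) r m r-large 1+m≡2r² refl (diagonal≤size s))
  where s = 1 + m * 2

proposition3p16 : ¬ HasLimitingDensity IsOneCycle
-- Both ends of the chain equal 97/168, so its strict inequality is absurd.
proposition3p16 (x , density) = ℚₚ.<-irrefl refl (begin-strict
  + 7 ℚ./ 12 ℚ.- ε         ≤⟨ ℚₚ.+-monoˡ-≤ (ℚ.- ε) (oneCycleRatio-odd r m r-large 1+m≡2r²) ⟩
  oneCycleRatio s₁ ℚ.- ε   <⟨ lower<upper x (proj₁ (close s₁ N≤s₁)) (proj₂ (close s₀ N≤s₀)) ⟩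
  oneCycleRatio s₀ ℚ.+ ε   ≤⟨ ℚₚ.+-monoˡ-≤ ε (oneCycleRatio-even N) ⟩
  + 4 ℚ./ 7 ℚ.+ ε          ∎)
  where
  open ℚₚ.≤-Reasoning
  -- half of 7/12 - 4/7
  ε : ℚ
  ε = + 1 ℚ./ 168
  -- The limit is required for all counting functions that meet the specifications, hence for the
  -- explicit ones.
  limit = density #presentations #oneCycles #presentations-isP #oneCycles-isP ε
    (ℚₚ.positive⁻¹ ε)
  N = proj₁ limit
  close = proj₂ limit
  s₀ = (1 + N) * 2
  N≤s₀ : N ≤ s₀
  N≤s₀ = ≤-trans (n≤1+n N) (m≤m*n (1 + N) 2)
  odd-length = large-enough N
  r = proj₁ odd-length
  m = proj₁ (proj₂ odd-length)
  s₁ = 1 + m * 2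
  r-large = proj₁ (proj₂ (proj₂ odd-length))
  1+m≡2r² = proj₁ (proj₂ (proj₂ (proj₂ odd-length)))
  N≤s₁ = proj₂ (proj₂ (proj₂ (proj₂ odd-length)))
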